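{- Let $(L,G)$ and $(K,H)$ be generator-enriched lattices such that there is a strong surjection from $(L,G)$ onto $(K,H)$. Then the minor poset $\mathrm{M}(K,H)$ can be obtained from $\mathrm{M}(L,G)$ via a sequence of zipping operations; that is, there is a finite (possibly empty) sequence of posets $P_0=\mathrm{M}(L,G),P_1,\dots,P_r$ with $P_r\cong \mathrm{M}(K,H)$ such that for each $1\le i\le r$ there is a zipper $x_i,y_i,z_i$ in $P_{i-1}$ with $P_i=\mathrm{zip}(P_{i-1},z_i)$.
   Context: A generator-enriched lattice is a pair $(L,G)$ where $L$ is a finite lattice and $G\subseteq L\setminus\{\widehat 0\}$ generates $L$ under joins (the empty join is $\widehat 0$). Elements of $G$ are called generators. For a set $H\subseteq L$ and $z\in L$ with $z<h$ for all $h\in H$, $\langle H|z\rangle=(\{z\vee\bigvee_{x\in X}x: X\subseteq H\},H)$, a generator-enriched lattice with minimum $z$ (joins computed in $L$). For $I\subseteq G$, the deletion is $(L,G)\setminus I=\langle G\setminus I\,|\,\widehat 0\rangle$ and the contraction is $(L,G)/I=\langle\{g\vee i_0: g\in G\}\setminus\{i_0\}\,|\,i_0\rangle$ where $i_0=\bigvee_{i\in I}i$. A minor of $(L,G)$ is any generator-enriched lattice obtained from $(L,G)$ by a (possibly empty) sequence of deletions and contractions. The minor poset $\mathrm{M}(L,G)$ consists of all minors of $(L,G)$ together with an adjoined minimum element $\emptyset$, ordered by $(K_1,H_1)\le(K_2,H_2)$ when $(K_1,H_1)$ is a minor of $(K_2,H_2)$. A strong map $f:(L,G)\to(K,H)$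 is a join-preserving map $f:L\to K$ (including the empty join, so $f(\widehat 0_L)=\widehat 0_K$) with $f(G)\subseteq H\cup\{\widehat 0_K\}$; it is surjective (a strong surjection) when $f(G\cup\{\widehat 0_L\})=H\cup\{\widehat 0_K\}$. Zipping: elements $x,y,z$ of a poset $P$ (with $x\neq y$) form a zipper if (i) $z$ covers exactly the two elements $x$ and $y$; (ii) $z=x\vee y$ (the join exists in $P$ and equals $z$); (iii) $\{p\in P:p<x\}=\{p\in P:p<y\}$. Given a zipper $x,y,z$, the poset $\mathrm{zip}(P,z)$ has underlying set $(P\setminus\{x,y,z\})\cup\{w\}$ with $w$ a new element, and for $p,q\in P\setminus\{x,y,z\}$: $p\le w$ iff $p\le z$ in $P$; $w\le p$ iff $x\le p$ or $y\le p$ in $P$; $p\le q$ iff $p\le q$ in $P$. -}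

module Defs where

open import Data.Empty using (⊥)
open import Data.Fin.Base using (Fin)
import Data.Fin.Properties as Fin
open import Data.Fin.Subset as Subset using (Subset; _⊆_; _─_; ⊤)
open import Data.Fin.Subset.Properties
  using (_∈?_; _⊆?_; anySubset?; ⊆-antisym; ⊆-trans; p─q⊆p; ⊆⊤)
open import Data.Nat.Base using (ℕ)
open import Data.List.Base using (foldr; map; filter; allFin)
open import Data.Product using (∃; ∃-syntax; _×_; _,_; proj₁; proj₂)
open import Data.Sum using (_⊎_)
import Data.Unit as Unit
open import Data.Vec.Base using (tabulate)
open import Data.Vec.Properties using (lookup∘tabulate; lookup⇒[]=; []=⇒lookup)
open import Function.Base using (_on_)
open import Function.Bundles using (_↔_; _⇔_; Inverse)
open import Function.Properties.Inverse using (↔⇒↣)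
open import Level using (0ℓ)
open import Relation.Binary using (Rel; Poset; Minimum; IsPartialOrder; DecidableEquality)
open import Relation.Binary.Construct.Closure.ReflexiveTransitive using (Star; ε; _◅_; _◅◅_)
import Relation.Binary.Construct.Add.Infimum.NonStrict as AddInfimum
open import Relation.Binary.Lattice using (IsLattice)
open import Relation.Binary.Morphism.Structures using (IsOrderIsomorphism)
import Relation.Binary.Properties.Poset as PosetProperties
open import Relation.Binary.PropositionalEquality
  using (_≡_; _≢_; refl; sym; trans; cong; subst)
open import Relation.Nullary using (¬_; does; yes; no)
open import Relation.Nullary.Decidable
  using (via-injection; _×-dec_; ¬?; dec-true)
open import Relation.Unary using (Pred; Decidable)

------------------------------------------------------------------------
-- Finite lattices and generator-enriched lattices

record FiniteLattice : Set₁ where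
  infix  4 _≤_ _∈_ _≟_
  infixr 6 _∨_
  infixr 7 _∧_
  field
    Carrier   : Set
    _≤_       : Rel Carrier 0ℓ
    _∨_ _∧_   : Carrier → Carrier → Carrier
    isLattice : IsLattice _≡_ _≤_ _∨_ _∧_
    0̂         : Carrier
    0̂-minimum : Minimum _≤_ 0̂
    size      : ℕ
    finite    : Carrier ↔ Fin size

  open IsLattice isLattice public
    using (isPartialOrder; antisym; x≤x∨y; y≤x∨y; ∨-least; reflexive)
    renaming (refl to ≤-refl; trans to ≤-trans)

  index : Carrier → Fin size
  index = Inverse.to finite

  element : Fin size → Carrier
  element = Inverse.from finite

  _≟_ : DecidableEquality Carrier
  _≟_ = via-injection (↔⇒↣ finite) Fin._≟_

  -- A subset of the lattice is a `Subset size`, read through `index`.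
  _∈_ : Carrier → Subset size → Set
  x ∈ S = index x Subset.∈ S

  comprehension : {P : Pred Carrier 0ℓ} → Decidable P → Subset size
  comprehension P? = tabulate (λ i → does (P? (element i)))

  ⋁ : Subset size → Carrier
  ⋁ X = foldr _∨_ 0̂ (map element (filter (_∈? X) (allFin size)))

record GeneratorEnrichedLattice : Set₁ where
  field
    lattice : FiniteLattice
  open FiniteLattice lattice public
  field
    G         : Subset size
    0̂∉G       : ¬ (0̂ ∈ G)
    generates : ∀ x → ∃[ X ] (X ⊆ G × x ≡ ⋁ X)

------------------------------------------------------------------------
-- Minors

module Minors (LG : GeneratorEnrichedLattice) where
  open GeneratorEnrichedLattice LG

  -- A pair (K , H) of subsets of L, together with the minimum of K.
  record Sub : Set where
    constructor sub
    field
      elements   : Subset size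
      generators : Subset size
      minimum    : Carrier

  open Sub public

  Spanned : Subset size → Carrier → Pred Carrier 0ℓ
  Spanned H z x = ∃[ X ] (X ⊆ H × x ≡ z ∨ ⋁ X)

  spanned? : ∀ H z → Decidable (Spanned H z)
  spanned? H z x = anySubset? (λ X → X ⊆? H ×-dec x ≟ z ∨ ⋁ X)

  span : Subset size → Carrier → Subset size
  span H z = comprehension (spanned? H z)

  -- Only used with z strictly below every element of H (see `Proper`).
  ⟨_∣_⟩ : Subset size → Carrier → Sub
  ⟨ H ∣ z ⟩ = sub (span H z) H z

  -- x ∈ { g ∨ i₀ : g ∈ H } ∖ { i₀ }
  Contracted : Subset size → Carrier → Pred Carrier 0ℓ
  Contracted H i₀ x = (∃[ g ] (g Subset.∈ H × x ≡ element g ∨ i₀)) × x ≢ i₀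

  contracted? : ∀ H i₀ → Decidable (Contracted H i₀)
  contracted? H i₀ x =
    Fin.any? (λ g → g ∈? H ×-dec x ≟ element g ∨ i₀) ×-dec ¬? (x ≟ i₀)

  infixl 5 _∖_ _/_

  _∖_ : Sub → Subset size → Sub
  M ∖ I = ⟨ generators M ─ I ∣ minimum M ⟩

  -- The join of I taken in M; joins in M agree with those in L, except that
  -- the empty join is the minimum of M.
  joinIn : Sub → Subset size → Carrier
  joinIn M I = minimum M ∨ ⋁ I

  _/_ : Sub → Subset size → Sub
  M / I = ⟨ comprehension (contracted? (generators M) (joinIn M I)) ∣ joinIn M I ⟩

  infix 4 _⟶_ _≼_

  data _⟶_ (M : Sub) : Sub → Set where
    delete   : ∀ I → I ⊆ generators M → M ⟶ M ∖ I
    contract : ∀ I → I ⊆ generators M → M ⟶ M / I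

  -- N ≼ M : N is a minor of M.
  _≼_ : Rel Sub 0ℓ
  N ≼ M = Star _⟶_ M N

  whole : Sub
  whole = sub ⊤ G 0̂

  Minor : Set
  Minor = ∃[ N ] N ≼ whole

  -- The lemmas up to `minor-isPartialOrder` show that ≼ orders the minors.

  comprehension⁻ : {P : Pred Carrier 0ℓ} (P? : Decidable P) →
                   ∀ {i} → i Subset.∈ comprehension P? → P (element i)
  comprehension⁻ P? {i} i∈ with P? (element i)
    | trans (sym (lookup∘tabulate (λ j → does (P? (element j))) i)) ([]=⇒lookup i∈)
  ... | yes p | _ = p
  ... | no  _ | ()

  comprehension⁺ : {P : Pred Carrier 0ℓ} (P? : Decidable P) →
                   ∀ {i} → P (element i) → i Subset.∈ comprehension P?
  comprehension⁺ P? {i} p = lookup⇒[]= i _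
    (trans (lookup∘tabulate _ i) (dec-true (P? (element i)) p))

  index-element : ∀ i → index (element i) ≡ i
  index-element i = Inverse.strictlyInverseˡ finite i

  ∨-identityˡ : ∀ {x z} → z ≤ x → z ∨ x ≡ x
  ∨-identityˡ z≤x = antisym (∨-least z≤x ≤-refl) (y≤x∨y _ _)

  ∨-identityʳ : ∀ {x z} → z ≤ x → x ∨ z ≡ x
  ∨-identityʳ z≤x = antisym (∨-least ≤-refl z≤x) (x≤x∨y _ _)

  record Proper (M : Sub) : Set where
    field
      elements≡span      : elements M ≡ span (generators M) (minimum M)
      minimum<generators : ∀ {g} → g Subset.∈ generators M →
                           minimum M ≤ element g × element g ≢ minimum M

  open Proper

  whole-proper : Proper whole
  whole-proper .elements≡span = ⊆-antisym (λ {i} _ → comprehension⁺ (spanned? G 0̂) (joins i)) ⊆⊤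
    where
    joins : ∀ i → ∃[ X ] (X ⊆ G × element i ≡ 0̂ ∨ ⋁ X)
    joins i with generates (element i)
    ... | X , X⊆G , eq = X , X⊆G , trans eq (sym (∨-identityˡ (0̂-minimum _)))
  whole-proper .minimum<generators {g} g∈G =
    0̂-minimum _ ,
    λ eq → 0̂∉G (subst (Subset._∈ G) (trans (sym (index-element g)) (cong index eq)) g∈G)

  ⟶-proper : ∀ {M N} → M ⟶ N → Proper M → Proper N
  ⟶-proper (delete I _) pr .elements≡span = refl
  ⟶-proper {M} (delete I _) pr .minimum<generators g∈ =
    minimum<generators pr (p─q⊆p (generators M) I g∈)
  ⟶-proper (contract I _) pr .elements≡span = refl
  ⟶-proper {M} (contract I _) pr .minimum<generators g∈
    with comprehension⁻ (contracted? (generators M) (joinIn M I)) g∈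
  ... | (_ , _ , eq) , g≢ = ≤-trans (y≤x∨y _ _) (reflexive (sym eq)) , g≢

  ≼-proper : ∀ {M N} → N ≼ M → Proper M → Proper N
  ≼-proper ε          pr = pr
  ≼-proper (s ◅ rest) pr = ≼-proper rest (⟶-proper s pr)

  Shrinks : Sub → Sub → Set
  Shrinks M N = minimum M ≤ minimum N ×
                (minimum M ≡ minimum N → generators N ⊆ generators M)

  ⟶-shrinks : ∀ {M N} → M ⟶ N → Proper M → Shrinks M N
  ⟶-shrinks {M} (delete I _)   pr = ≤-refl , λ _ → p─q⊆p (generators M) I
  ⟶-shrinks {M} (contract I _) pr = x≤x∨y _ _ , same
    where
    same : minimum M ≡ joinIn M I → generators (M / I) ⊆ generators M
    same z≡ {i} i∈ with comprehension⁻ (contracted? (generators M) (joinIn M I)) i∈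
    ... | (g , g∈ , eq) , _ = subst (Subset._∈ generators M) g≡i g∈
      where
      g≡i : g ≡ i
      g≡i = trans (sym (index-element g)) (trans (cong index (sym
              (trans eq (∨-identityʳ (subst (_≤ element g) z≡
                (proj₁ (minimum<generators pr g∈))))))) (index-element i))

  ≼-shrinks : ∀ {M N} → N ≼ M → Proper M → Shrinks M N
  ≼-shrinks ε          pr = ≤-refl , λ _ z → z
  ≼-shrinks {M} {N} (_◅_ {j = P} s rest) pr
    with ⟶-shrinks s pr | ≼-shrinks rest (⟶-proper s pr)
  ... | z≤ , H⊆ | z≤′ , H⊆′ = ≤-trans z≤ z≤′ , same
    where
    same : minimum M ≡ minimum N → generators N ⊆ generators M
    same eq = ⊆-trans (H⊆′ (trans (sym M≡P) eq)) (H⊆ M≡P)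
      where
      M≡P : minimum M ≡ minimum P
      M≡P = antisym z≤ (≤-trans z≤′ (reflexive (sym eq)))

  ≼-antisym : ∀ {M N} → Proper M → Proper N → M ≼ N → N ≼ M → M ≡ N
  ≼-antisym {sub _ H z} {sub _ H′ z′} prM prN M≼N N≼M
    with ≼-shrinks N≼M prM | ≼-shrinks M≼N prN
  ... | z≤ , H⊆ | z≥ , H⊇ with antisym z≤ z≥
  ... | refl with ⊆-antisym (H⊇ refl) (H⊆ refl)
  ... | refl with trans (elements≡span prM) (sym (elements≡span prN))
  ... | refl = refl

  minor-isPartialOrder : IsPartialOrder {A = Minor} (_≡_ on proj₁) (_≼_ on proj₁)
  minor-isPartialOrder = record
    { isPreorder = record
      { isEquivalence = record { refl = refl ; sym = sym ; trans = trans }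
      ; reflexive     = λ { refl → ε }
      ; trans         = λ p q → q ◅◅ p
      }
    ; antisym = λ {M} {N} →
        ≼-antisym (≼-proper (proj₂ M) whole-proper) (≼-proper (proj₂ N) whole-proper)
    }

  minorPoset : Poset 0ℓ 0ℓ 0ℓ
  minorPoset = record
    { isPartialOrder = AddInfimum.≤₋-isPartialOrder (_≼_ on proj₁) minor-isPartialOrder }

M : GeneratorEnrichedLattice → Poset 0ℓ 0ℓ 0ℓ
M = Minors.minorPoset

------------------------------------------------------------------------
-- Strong maps

module _ (LG KH : GeneratorEnrichedLattice) where
  private
    module L = GeneratorEnrichedLattice LG
    module K = GeneratorEnrichedLattice KH

  record IsStrongMap (f : L.Carrier → K.Carrier) : Set where
    field
      preserves-0̂ : f L.0̂ ≡ K.0̂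
      preserves-∨ : ∀ x y → f (x L.∨ y) ≡ f x K.∨ f y
      generators  : ∀ {g} → g L.∈ L.G → f g K.∈ K.G ⊎ f g ≡ K.0̂

  record IsStrongSurjection (f : L.Carrier → K.Carrier) : Set where
    field
      isStrongMap : IsStrongMap f
      surjective  : ∀ y → (y K.∈ K.G ⊎ y ≡ K.0̂) ⇔
                          (∃[ x ] ((x L.∈ L.G ⊎ x ≡ L.0̂) × f x ≡ y))

------------------------------------------------------------------------
-- Zipping

module Zipping (P : Poset 0ℓ 0ℓ 0ℓ) where
  open Poset P
  open PosetProperties P using (_<_)

  _Covers_ : Rel Carrier 0ℓ
  q Covers p = p < q × (∀ r → ¬ (p < r × r < q))

  record IsJoin (x y z : Carrier) : Set where
    field
      x≤z   : x ≤ z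
      y≤z   : y ≤ z
      least : ∀ u → x ≤ u → y ≤ u → z ≤ u

  record IsZipper (x y z : Carrier) : Set where
    field
      x≉y        : x ≉ y
      covers     : ∀ p → z Covers p ⇔ (p ≈ x ⊎ p ≈ y)
      isJoin     : IsJoin x y z
      same-below : ∀ p → p < x ⇔ p < y

  module Zip (x y z : Carrier) where

    data Zipped : Set where
      old : (p : Carrier) → p ≉ x → p ≉ y → p ≉ z → Zipped
      w   : Zipped

    infix 4 _≈ᶻ_ _≤ᶻ_

    _≈ᶻ_ : Rel Zipped 0ℓ
    old p _ _ _ ≈ᶻ old q _ _ _ = p ≈ q
    old _ _ _ _ ≈ᶻ w           = ⊥
    w           ≈ᶻ old _ _ _ _ = ⊥
    w           ≈ᶻ w           = Unit.⊤

    _≤ᶻ_ : Rel Zipped 0ℓ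
    old p _ _ _ ≤ᶻ old q _ _ _ = p ≤ q
    old p _ _ _ ≤ᶻ w           = p ≤ z
    w           ≤ᶻ old q _ _ _ = x ≤ q ⊎ y ≤ q
    w           ≤ᶻ w           = Unit.⊤

infix 4 _zipsTo_ _≅_

-- For finite P the zipped relation is always a partial order. As finiteness is
-- not part of `Poset`, this is required at each step: transitivity at w needs
-- every p < z to lie below an element covered by z.
data _zipsTo_ (P : Poset 0ℓ 0ℓ 0ℓ) : Poset 0ℓ 0ℓ 0ℓ → Set₁ where
  zip : ∀ x y z → Zipping.IsZipper P x y z →
        (isPO : IsPartialOrder (Zipping.Zip._≈ᶻ_ P x y z) (Zipping.Zip._≤ᶻ_ P x y z)) →
        P zipsTo record { isPartialOrder = isPO }

_≅_ : Rel (Poset 0ℓ 0ℓ 0ℓ) 0ℓ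
P ≅ Q = ∃[ f ] IsOrderIsomorphism P._≈_ Q._≈_ P._≤_ Q._≤_ f
  where
  module P = Poset P
  module Q = Poset Q

infix 4 _ZipsTo*_

_ZipsTo*_ : Poset 0ℓ 0ℓ 0ℓ → Poset 0ℓ 0ℓ 0ℓ → Set₁
P ZipsTo* Q = ∃[ R ] (Star _zipsTo_ P R × R ≅ Q)

-- A minor of (L , G) is a pair (z , A) with z in L and A a set of generators,
-- standing for ⟨ { g ∨ z : g ∈ A } ∖ { z } ∣ z ⟩. A surjective join map f out of
-- L amounts to the join-congruence ker f, and the pairs (z , A) also encode the
-- minors of the image; so every poset in the sequence is a quotient of a
-- preorder on this one set of pairs, with an added minimum.
--
-- Equality is coarsened to ker f by running through the elements a of L from
-- the top down. When a is reached, everything above it is already collapsed, so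
-- in the current quotient either a is alone in its class or it has a unique
-- upper cover b with f a = f b, and a is identified with b. The nontrivial
-- fibres of the induced map on minors are then triples, {(a , A), (b , A),
-- (a , A ∪ {b})} or {(z , A ∪ {a}), (z , A ∪ {b}), (z , A ∪ {a , b})}, whose last
-- member is the join of the other two. Since minors lift along strong
-- surjections, such a triple is a zipper as soon as all the fibres below it
-- have become points, so the triples can be zipped from the bottom up.

module Submission where

open import Defs
open import Data.Bool.Base using (true; false)
open import Data.Empty using (⊥-elim)
open import Data.Fin.Base using (Fin; zero; suc)
import Data.Fin.Properties as Fin
open import Data.Fin.Subset using (Subset; _∈_; _⊆_; _∪_; _─_; ⁅_⁆)
open import Data.Fin.Subset.Properties 
  using (_∈?_; ⊆-antisym; x∈p∪q⁺; x∈p∪q⁻; x∈⁅x⁆; x∈⁅y⁆⇒x≡y; p─q⊆p; x∈p∧x∉q⇒x∈p─q)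
open import Data.List.Base using (List; []; _∷_; _++_; map; cartesianProduct; foldr; filter; allFin)
open import Data.List.Membership.Propositional using () renaming (_∈_ to _∈ₗ_)
open import Data.List.Membership.Propositional.Properties
  using (∈-map⁺; ∈-++⁺ˡ; ∈-++⁺ʳ; ∈-cartesianProduct⁺; ∈-map⁻; ∈-filter⁺; ∈-filter⁻; ∈-allFin)
import Data.List.Membership.DecPropositional as Membership
open import Data.List.Relation.Unary.All using (All; []; _∷_)
import Data.List.Relation.Unary.All as All
open import Data.List.Relation.Unary.AllPairs using (AllPairs; []; _∷_)
open import Data.List.Relation.Unary.Any using (Any; here; there)
import Data.List.Relation.Unary.Any as Any
import Data.Maybe.Base as Maybe
open import Data.Nat.Base using (ℕ; zero; suc)
open import Data.Product using (∃-syntax; _×_; _,_; proj₁; proj₂)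
open import Data.Sum using (_⊎_; inj₁; inj₂)
import Data.Unit as Unit
open import Data.Vec.Base using ([]; _∷_; here; there; tabulate)
open import Data.Vec.Properties using (lookup∘tabulate; lookup⇒[]=; []=⇒lookup)
open import Function.Base using (_∘_)
open import Function.Bundles using (Inverse; Equivalence; mk⇔)
open import Level using (0ℓ)
open import Relation.Binary using (Rel; Poset; IsPartialOrder; Reflexive; Transitive; Decidable; DecidableEquality)
import Relation.Binary.Construct.Add.Infimum.Equality as InfimumEquality
import Relation.Binary.Construct.Add.Infimum.NonStrict as AddInfimum
open import Relation.Binary.Construct.Closure.ReflexiveTransitive using (Star; ε; _◅_; _◅◅_)
open import Relation.Binary.Construct.Interior.Symmetric using (SymInterior; _,_; lhs≤rhs; rhs≤lhs)
import Relation.Binary.Construct.Interior.Symmetric as Symmetric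
import Relation.Binary.Morphism.OrderMonomorphism as OrderMonomorphism
import Relation.Binary.Properties.Poset as PosetProperties
open import Relation.Binary.PropositionalEquality using (_≡_; _≢_; refl; sym; trans; cong; subst)
open import Relation.Nullary using (¬_; Dec; does; yes; no; contradiction)
open import Relation.Nullary.Construct.Add.Infimum using (_₋; ⊥₋; [_])
open import Relation.Nullary.Decidable using (map′; _×-dec_; _⊎-dec_; _→-dec_; ¬?; dec-true)
open import Relation.Unary using () renaming (Decidable to UnaryDecidable)

-- Preorders and zipping

module TopologicalSort {C : Set} {_<_ : Rel C 0ℓ} (<-irrefl : ∀ {x} → ¬ x < x)
                       (<-trans : Transitive _<_) (_<?_ : Decidable _<_) where

  Sorted : List C → Set
  Sorted = AllPairs (λ x y → ¬ y < x)

  insert : C → List C → List C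
  insert x []      = x ∷ []
  insert x (y ∷ l) with x <? y
  ... | yes _ = x ∷ y ∷ l
  ... | no  _ = y ∷ insert x l

  insert-All : ∀ {P : C → Set} {x} l → P x → All P l → All P (insert x l)
  insert-All     []      px []         = px ∷ []
  insert-All {x = x} (y ∷ l) px (py ∷ pl) with x <? y
  ... | yes _ = px ∷ py ∷ pl
  ... | no  _ = py ∷ insert-All l px pl

  -- Inserting in front of the first larger `y` is enough for a partial order: a later `d < x` would
  -- give `d < y` by transitivity, against sortedness. The entries passed over satisfy `¬ x < y` by
  -- the test itself.
  insert-sorted : ∀ {x} l → Sorted l → Sorted (insert x l)
  insert-sorted     []      []       = [] ∷ []
  insert-sorted {x} (y ∷ l) (y≮ ∷ s) with x <? y
  ... | yes x<y = ((λ y<x → <-irrefl (<-trans x<y y<x)) ∷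
                   All.map (λ d≮y d<x → d≮y (<-trans d<x x<y)) y≮) ∷ y≮ ∷ s
  ... | no  x≮y = insert-All l x≮y y≮ ∷ insert-sorted l s

  ∈-insert : ∀ {x c} l → c ∈ₗ x ∷ l → c ∈ₗ insert x l
  ∈-insert     []      c∈ = c∈
  ∈-insert {x} (y ∷ l) c∈ with x <? y
  ∈-insert (y ∷ l) c∈                | yes _ = c∈
  ∈-insert (y ∷ l) (here eq)         | no  _ = there (∈-insert l (here eq))
  ∈-insert (y ∷ l) (there (here eq)) | no  _ = here eq
  ∈-insert (y ∷ l) (there (there c∈)) | no  _ = there (∈-insert l (there c∈))

  sort : List C → List C
  sort []      = []
  sort (x ∷ l) = insert x (sort l)

  sort-sorted : ∀ l → Sorted (sort l)
  sort-sorted []      = []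
  sort-sorted (x ∷ l) = insert-sorted (sort l) (sort-sorted l)

  ∈-sort : ∀ {c} l → c ∈ₗ l → c ∈ₗ sort l
  ∈-sort (x ∷ l) (here eq)  = ∈-insert (sort l) (here eq)
  ∈-sort (x ∷ l) (there c∈) = ∈-insert (sort l) (there (∈-sort l c∈))

record DecidablePreorder (C : Set) : Set₁ where
  infix 4 _≲_ _≲?_ _≈_ _<_
  field
    _≲_     : Rel C 0ℓ
    ≲-refl  : Reflexive _≲_
    ≲-trans : Transitive _≲_
    _≲?_    : Decidable _≲_

  _≈_ : Rel C 0ℓ
  _≈_ = SymInterior _≲_

  ≈-sym : ∀ {x y} → x ≈ y → y ≈ x
  ≈-sym (x≲y , y≲x) = y≲x , x≲y

  ≈-trans : Transitive _≈_
  ≈-trans (x≲y , y≲x) (y≲z , z≲y) = ≲-trans x≲y y≲z , ≲-trans z≲y y≲x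

  _≈?_ : Decidable _≈_
  x ≈? y = map′ (λ (p , q) → p , q) (λ (p , q) → p , q) ((x ≲? y) ×-dec (y ≲? x))

  _<_ : Rel C 0ℓ
  x < y = x ≲ y × ¬ y ≲ x

  <-irrefl : ∀ {x} → ¬ x < x
  <-irrefl (x≲x , x≴x) = x≴x x≲x

  <-trans : Transitive _<_
  <-trans (x≲y , y≴x) (y≲z , _) = ≲-trans x≲y y≲z , λ z≲x → y≴x (≲-trans y≲z z≲x)

  _<?_ : Decidable _<_
  x <? y = (x ≲? y) ×-dec ¬? (y ≲? x)

  quotient : Poset 0ℓ 0ℓ 0ℓ
  quotient = Symmetric.poset {R = _≲_} ≲-refl ≲-trans

infix 4 _⇄_

-- The inverse is kept as data so that zippers of a preorder can be carried back to `R`. By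
-- antisymmetry `mono` and `cancel` already make `to` respect and reflect equality.
record _⇄_ (P Q : Poset 0ℓ 0ℓ 0ℓ) : Set where
  private
    module P = Poset P
    module Q = Poset Q
  field
    to      : P.Carrier → Q.Carrier
    from    : Q.Carrier → P.Carrier
    mono    : ∀ {p q} → p P.≤ q → to p Q.≤ to q
    cancel  : ∀ {p q} → to p Q.≤ to q → p P.≤ q
    to-from : ∀ q → to (from q) Q.≈ q

  to-cong : ∀ {p q} → p P.≈ q → to p Q.≈ to q
  to-cong p≈q = Q.antisym (mono (P.reflexive p≈q)) (mono (P.reflexive (P.Eq.sym p≈q)))

  injective : ∀ {p q} → to p Q.≈ to q → p P.≈ q
  injective eq = P.antisym (cancel (Q.reflexive eq)) (cancel (Q.reflexive (Q.Eq.sym eq)))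

  ≤-from : ∀ {p q} → to p Q.≤ q → p P.≤ from q
  ≤-from le = cancel (Q.trans le (Q.reflexive (Q.Eq.sym (to-from _))))

  from-≤ : ∀ {p q} → q Q.≤ to p → from q P.≤ p
  from-≤ le = cancel (Q.trans (Q.reflexive (to-from _)) le)

  to-≤ : ∀ {p q} → p P.≤ from q → to p Q.≤ q
  to-≤ le = Q.trans (mono le) (Q.reflexive (to-from _))

  ≤-to : ∀ {p q} → from q P.≤ p → q Q.≤ to p
  ≤-to le = Q.trans (Q.reflexive (Q.Eq.sym (to-from _))) (mono le)

  ≈-from : ∀ {p q} → to p Q.≈ q → p P.≈ from q
  ≈-from eq = injective (Q.Eq.trans eq (Q.Eq.sym (to-from _)))

  to-≈ : ∀ {p q} → p P.≈ from q → to p Q.≈ q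
  to-≈ eq = Q.Eq.trans (to-cong eq) (to-from _)

⇄-sym : ∀ {P Q} → P ⇄ Q → Q ⇄ P
⇄-sym {P} {Q} e = record
  { to      = from
  ; from    = to
  ; mono    = λ p≤q → ≤-from (Q.trans (Q.reflexive (to-from _)) p≤q)
  ; cancel  = λ le → Q.trans (≤-to le) (Q.reflexive (to-from _))
  ; to-from = λ p → injective (to-from (to p))
  }
  where
  open _⇄_ e
  module Q = Poset Q

⇄-trans : ∀ {P Q R} → P ⇄ Q → Q ⇄ R → P ⇄ R
⇄-trans {R = R} e f = record
  { to      = F.to ∘ E.to
  ; from    = E.from ∘ F.from
  ; mono    = F.mono ∘ E.mono
  ; cancel  = E.cancel ∘ F.cancel
  ; to-from = λ r → F.to-≈ (E.to-from (F.from r))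
  }
  where
  module E = _⇄_ e
  module F = _⇄_ f

⇄⇒≅ : ∀ {P Q} → P ⇄ Q → P ≅ Q
⇄⇒≅ {P} {Q} e = to , record
  { isOrderMonomorphism = record
    { isOrderHomomorphism = record { cong = to-cong ; mono = mono }
    ; injective = injective
    ; cancel    = cancel
    }
  ; surjective = λ q → from q , λ eq → Poset.Eq.trans Q (to-cong eq) (to-from q)
  }
  where open _⇄_ e

-- Zippers in a preorder and the zipped poset

module _ {C : Set} (P : DecidablePreorder C) where
  open DecidablePreorder P

  -- `below` packs both conditions on the elements under `z`: it leaves only `x` and `y` to be
  -- covered by `z`, and it gives these two the same elements strictly below them. It also provides
  -- what transitivity at the new point requires.
  record Zipper (x y z : C) : Set where
    field
      x≲z    : x ≲ z
      y≲z    : y ≲ z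
      x≴y    : ¬ x ≲ y
      y≴x    : ¬ y ≲ x
      below  : ∀ {p} → p ≲ z → (p ≈ x ⊎ p ≈ y ⊎ p ≈ z) ⊎ (p ≲ x × p ≲ y)
      isJoin : ∀ {u} → x ≲ u → y ≲ u → z ≲ u

  swap : ∀ {x y z} → Zipper x y z → Zipper y x z
  swap zipper = record
    { x≲z = y≲z ; y≲z = x≲z ; x≴y = y≴x ; y≴x = x≴y
    ; below  = λ p≲z → swap-below (below p≲z)
    ; isJoin = λ y≲u x≲u → isJoin x≲u y≲u
    }
    where
    open Zipper zipper
    swap-below : ∀ {A B C D E : Set} → (A ⊎ B ⊎ C) ⊎ (D × E) → (B ⊎ A ⊎ C) ⊎ (E × D)
    swap-below (inj₁ (inj₁ a))        = inj₁ (inj₂ (inj₁ a))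
    swap-below (inj₁ (inj₂ (inj₁ b))) = inj₁ (inj₁ b)
    swap-below (inj₁ (inj₂ (inj₂ c))) = inj₁ (inj₂ (inj₂ c))
    swap-below (inj₂ (d , e))         = inj₂ (e , d)

  module _ (x y z : C) where

    -- The preorder generated by adding `z ≲ x` and `z ≲ y`; a chain with several added links
    -- shortens to one with a single added link. The carrier is unchanged, so merges can be
    -- iterated.
    merge : DecidablePreorder C
    merge = record
      { _≲_     = λ p q → p ≲ q ⊎ (p ≲ z × (x ≲ q ⊎ y ≲ q))
      ; ≲-refl  = inj₁ ≲-refl
      ; ≲-trans = tr
      ; _≲?_    = λ p q → (p ≲? q) ⊎-dec ((p ≲? z) ×-dec ((x ≲? q) ⊎-dec (y ≲? q)))
      }
      where
      tr : Transitive (λ p q → p ≲ q ⊎ (p ≲ z × (x ≲ q ⊎ y ≲ q)))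
      tr (inj₁ p≲q)              (inj₁ q≲r)       = inj₁ (≲-trans p≲q q≲r)
      tr (inj₁ p≲q)              (inj₂ (q≲z , r)) = inj₂ (≲-trans p≲q q≲z , r)
      tr (inj₂ (p≲z , inj₁ x≲q)) (inj₁ q≲r)       = inj₂ (p≲z , inj₁ (≲-trans x≲q q≲r))
      tr (inj₂ (p≲z , inj₂ y≲q)) (inj₁ q≲r)       = inj₂ (p≲z , inj₂ (≲-trans y≲q q≲r))
      tr (inj₂ (p≲z , _))        (inj₂ (_ , r))   = inj₂ (p≲z , r)

  module _ {R : Poset 0ℓ 0ℓ 0ℓ} (e : R ⇄ quotient) {x y z : C} where
    private
      module R = Poset R
    open _⇄_ e
    open PosetProperties R using () renaming (_<_ to _<ᴿ_)
    open Zipping R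

    Covers-x : Zipper x y z → ∀ {p} → p R.≈ from x → from z Covers p
    Covers-x zipper {p} p≈x =
      (R.trans (R.reflexive p≈x) (from-≤ (≲-trans x≲z (rhs≤lhs (to-from z)))) ,
       λ p≈z → z≴x (≲-trans (≤-to (R.reflexive (R.Eq.sym p≈z))) (to-≤ (R.reflexive p≈x)))) ,
      between
      where
      open Zipper zipper
      z≴x : ¬ z ≲ x
      z≴x z≲x = y≴x (≲-trans y≲z z≲x)
      x≲ : ∀ {q} → p R.≤ q → x ≲ to q
      x≲ p≤q = ≤-to (R.trans (R.reflexive (R.Eq.sym p≈x)) p≤q)
      between : ∀ r → ¬ (p <ᴿ r × r <ᴿ from z)
      between r ((p≤r , p≉r) , (r≤z , r≉z)) with below (to-≤ r≤z)
      ... | inj₁ (inj₁ r≈x)        = p≉r (R.Eq.trans p≈x (R.Eq.sym (≈-from r≈x)))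
      ... | inj₁ (inj₂ (inj₁ r≈y)) = x≴y (≲-trans (x≲ p≤r) (lhs≤rhs r≈y))
      ... | inj₁ (inj₂ (inj₂ r≈z)) = r≉z (≈-from r≈z)
      ... | inj₂ (r≲x , _)         =
        p≉r (R.antisym p≤r (R.trans (≤-from r≲x) (R.reflexive (R.Eq.sym p≈x))))

    <-x⇒<-y : Zipper x y z → ∀ {p} → p <ᴿ from x → p <ᴿ from y
    <-x⇒<-y zipper (p≤x , p≉x) with Zipper.below zipper (≲-trans (to-≤ p≤x) (Zipper.x≲z zipper))
    ... | inj₁ (inj₁ p≈x)        = contradiction (≈-from p≈x) p≉x
    ... | inj₁ (inj₂ (inj₁ p≈y)) =
      contradiction (≲-trans (rhs≤lhs p≈y) (to-≤ p≤x)) (Zipper.y≴x zipper)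
    ... | inj₁ (inj₂ (inj₂ p≈z)) =
      contradiction (≲-trans (Zipper.y≲z zipper) (≲-trans (rhs≤lhs p≈z) (to-≤ p≤x)))
                    (Zipper.y≴x zipper)
    ... | inj₂ (_ , p≲y) = ≤-from p≲y ,
      λ p≈y → Zipper.y≴x zipper (≲-trans (≤-to (R.reflexive (R.Eq.sym p≈y))) (to-≤ p≤x))

  module ZipStep {R : Poset 0ℓ 0ℓ 0ℓ} (e : R ⇄ quotient) {x y z : C} (zipper : Zipper x y z) where
    private
      module R = Poset R
      module Q = DecidablePreorder (merge x y z)
    open _⇄_ e
    open Zipper zipper
    open Zipping R using (IsZipper; _Covers_)
    open Zipping.Zip R (from x) (from y) (from z)

    isZipper : IsZipper (from x) (from y) (from z)
    isZipper = record
      { x≉y        = λ x≈y → x≴y (≲-trans (≤-to (R.reflexive x≈y)) (lhs≤rhs (to-from y)))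
      ; covers     = λ p → mk⇔ covered λ
          { (inj₁ p≈x) → Covers-x e zipper p≈x
          ; (inj₂ p≈y) → Covers-x e (swap zipper) p≈y }
      ; isJoin     = record
        { x≤z   = from-≤ (≲-trans x≲z (rhs≤lhs (to-from z)))
        ; y≤z   = from-≤ (≲-trans y≲z (rhs≤lhs (to-from z)))
        ; least = λ u x≤u y≤u → from-≤ (isJoin (≤-to x≤u) (≤-to y≤u))
        }
      ; same-below = λ p → mk⇔ (<-x⇒<-y e zipper) (<-x⇒<-y e (swap zipper))
      }
      where
      covered : ∀ {p} → from z Covers p → p R.≈ from x ⊎ p R.≈ from y
      covered {p} ((p≤z , p≉z) , between) with below (to-≤ p≤z)
      ... | inj₁ (inj₁ p≈x)        = inj₁ (≈-from p≈x)
      ... | inj₁ (inj₂ (inj₁ p≈y)) = inj₂ (≈-from p≈y)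
      ... | inj₁ (inj₂ (inj₂ p≈z)) = contradiction (≈-from p≈z) p≉z
      -- If `p` is not equal to `x`, then `x` lies strictly between `p` and `z`, which contradicts
      -- the cover.
      ... | inj₂ (p≲x , p≲y) with x ≲? to p
      ...   | yes x≲p = inj₁ (≈-from (p≲x , x≲p))
      ...   | no  x≴p = contradiction
        ((≤-from p≲x , λ p≈x → x≴p (≤-to (R.reflexive (R.Eq.sym p≈x)))) ,
         proj₁ (Covers-x e zipper R.Eq.refl))
        (between (from x))

    to′ : Zipped → C
    to′ (old p _ _ _) = to p
    to′ w             = z

    mono′ : ∀ s t → s ≤ᶻ t → to′ s Q.≲ to′ t
    mono′ (old p _ _ _) (old q _ _ _) p≤q        = inj₁ (mono p≤q)
    mono′ (old p _ _ _) w             p≤z        = inj₁ (to-≤ p≤z)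
    mono′ w             (old q _ _ _) (inj₁ x≤q) = inj₂ (≲-refl , inj₁ (≤-to x≤q))
    mono′ w             (old q _ _ _) (inj₂ y≤q) = inj₂ (≲-refl , inj₂ (≤-to y≤q))
    mono′ w             w             _          = inj₁ ≲-refl

    old-below : ∀ {p} → p R.≉ from x → p R.≉ from y → p R.≉ from z →
                to p ≲ z → to p ≲ x × to p ≲ y
    old-below p≉x p≉y p≉z p≲z with below p≲z
    ... | inj₁ (inj₁ p≈x)        = contradiction (≈-from p≈x) p≉x
    ... | inj₁ (inj₂ (inj₁ p≈y)) = contradiction (≈-from p≈y) p≉y
    ... | inj₁ (inj₂ (inj₂ p≈z)) = contradiction (≈-from p≈z) p≉z
    ... | inj₂ p≲xy              = p≲xy

    -- A relation between old points that arises through `z` was there before: by `below`, an old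
    -- point under `z` is under both `x` and `y`.
    cancel′ : ∀ s t → to′ s Q.≲ to′ t → s ≤ᶻ t
    cancel′ (old p _ _ _) (old q _ _ _) (inj₁ p≲q) = cancel p≲q
    cancel′ (old p a b c) (old q _ _ _) (inj₂ (p≲z , inj₁ x≲q)) =
      cancel (≲-trans (proj₁ (old-below a b c p≲z)) x≲q)
    cancel′ (old p a b c) (old q _ _ _) (inj₂ (p≲z , inj₂ y≲q)) =
      cancel (≲-trans (proj₂ (old-below a b c p≲z)) y≲q)
    cancel′ (old p _ _ _) w             (inj₁ p≲z)       = ≤-from p≲z
    cancel′ (old p _ _ _) w             (inj₂ (p≲z , _)) = ≤-from p≲z
    cancel′ w             (old q _ _ _) (inj₁ z≲q)            = inj₁ (from-≤ (≲-trans x≲z z≲q))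
    cancel′ w             (old q _ _ _) (inj₂ (_ , inj₁ x≲q)) = inj₁ (from-≤ x≲q)
    cancel′ w             (old q _ _ _) (inj₂ (_ , inj₂ y≲q)) = inj₂ (from-≤ y≲q)
    cancel′ w             w             _                     = Unit.tt

    ≈ᶻ⇒≤ᶻ : ∀ s t → s ≈ᶻ t → s ≤ᶻ t × t ≤ᶻ s
    ≈ᶻ⇒≤ᶻ (old p _ _ _) (old q _ _ _) p≈q = R.reflexive p≈q , R.reflexive (R.Eq.sym p≈q)
    ≈ᶻ⇒≤ᶻ w             w             _   = Unit.tt , Unit.tt

    -- Antisymmetry at the new point: an old `p` under `z` is under both `x` and `y`, so either
    -- alternative would make `x` and `y` comparable.
    w-not-old : ∀ {p} → p R.≉ from x → p R.≉ from y → p R.≉ from z →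
                p R.≤ from z → ¬ (from x R.≤ p ⊎ from y R.≤ p)
    w-not-old a b c p≤z (inj₁ x≤p) = x≴y (≲-trans (≤-to x≤p) (proj₂ (old-below a b c (to-≤ p≤z))))
    w-not-old a b c p≤z (inj₂ y≤p) = y≴x (≲-trans (≤-to y≤p) (proj₁ (old-below a b c (to-≤ p≤z))))

    ≤ᶻ-antisym : ∀ s t → s ≤ᶻ t → t ≤ᶻ s → s ≈ᶻ t
    ≤ᶻ-antisym (old p _ _ _) (old q _ _ _) p≤q q≤p = R.antisym p≤q q≤p
    ≤ᶻ-antisym (old p a b c) w             p≤w w≤p = w-not-old a b c p≤w w≤p
    ≤ᶻ-antisym w             (old q a b c) w≤q q≤w = w-not-old a b c q≤w w≤q
    ≤ᶻ-antisym w             w             _   _   = Unit.tt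

    -- The axioms are pulled back along `to′` from the quotient of the merged preorder, so
    -- transitivity through `w` needs no argument of its own.
    zipped-isPartialOrder : IsPartialOrder _≈ᶻ_ _≤ᶻ_
    zipped-isPartialOrder = OrderMonomorphism.isPartialOrder
      {_≈₁_ = _≈ᶻ_} {_≈₂_ = Q._≈_} {_≲₁_ = _≤ᶻ_} {_≲₂_ = Q._≲_} {⟦_⟧ = to′}
      (record
        { isOrderHomomorphism = record
          { cong = λ {s} {t} s≈t →
              mono′ s t (proj₁ (≈ᶻ⇒≤ᶻ s t s≈t)) , mono′ t s (proj₂ (≈ᶻ⇒≤ᶻ s t s≈t))
          ; mono = λ {s} {t} → mono′ s t
          }
        ; injective = λ {s} {t} eq →
            ≤ᶻ-antisym s t (cancel′ s t (lhs≤rhs eq)) (cancel′ t s (rhs≤lhs eq))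
        ; cancel = λ {s} {t} → cancel′ s t
        })
      (Poset.isPartialOrder Q.quotient)

    zipped : Poset 0ℓ 0ℓ 0ℓ
    zipped = record { isPartialOrder = zipped-isPartialOrder }

    x≈z : x Q.≈ z
    x≈z = inj₁ x≲z , inj₂ (≲-refl , inj₁ ≲-refl)

    y≈z : y Q.≈ z
    y≈z = inj₁ y≲z , inj₂ (≲-refl , inj₂ ≲-refl)

    ≈⇒Q≈ : ∀ {p q} → p ≈ q → p Q.≈ q
    ≈⇒Q≈ (p≲q , q≲p) = inj₁ p≲q , inj₁ q≲p

    preimage : ∀ c → ∃[ s ] to′ s Q.≈ c
    preimage c with c ≈? x | c ≈? y | c ≈? z
    ... | yes c≈x | _ | _ = w , Q.≈-trans (Q.≈-sym x≈z) (≈⇒Q≈ (≈-sym c≈x))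
    ... | no _ | yes c≈y | _ = w , Q.≈-trans (Q.≈-sym y≈z) (≈⇒Q≈ (≈-sym c≈y))
    ... | no _ | no _ | yes c≈z = w , ≈⇒Q≈ (≈-sym c≈z)
    ... | no c≉x | no c≉y | no c≉z =
      old (from c) (c≉x ∘ from-inj) (c≉y ∘ from-inj) (c≉z ∘ from-inj) , ≈⇒Q≈ (to-from c)
      where
      from-inj : ∀ {d} → from c R.≈ from d → c ≈ d
      from-inj eq = ≈-trans (≈-sym (to-from c)) (to-≈ eq)

    zip-step : ∃[ R′ ] (R zipsTo R′ × R′ ⇄ Q.quotient)
    zip-step = zipped , zip (from x) (from y) (from z) isZipper zipped-isPartialOrder , record
      { to      = to′
      ; from    = proj₁ ∘ preimage
      ; mono    = λ {s} {t} → mono′ s t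
      ; cancel  = λ {s} {t} → cancel′ s t
      ; to-from = proj₂ ∘ preimage
      }

infix 4 _↝_

-- Each zip creates a new carrier, so the posets reached are only equivalent to the quotients.
-- Quantifying over every such `R` makes the steps composable and allows a sequence to start at a
-- prescribed poset.
_↝_ : {C : Set} → DecidablePreorder C → DecidablePreorder C → Set₁
P ↝ Q = ∀ {R} → R ⇄ DecidablePreorder.quotient P →
        ∃[ R′ ] (Star _zipsTo_ R R′ × R′ ⇄ DecidablePreorder.quotient Q)

module _ {C : Set} where
  open DecidablePreorder

  ↝-trans : {P Q R : DecidablePreorder C} → P ↝ Q → Q ↝ R → P ↝ R
  ↝-trans f g e with f e
  ... | _ , steps , e′ with g e′
  ...   | _ , steps′ , e″ = _ , steps ◅◅ steps′ , e″

  same⇒↝ : (P Q : DecidablePreorder C) → (∀ {p q} → _≲_ P p q → _≲_ Q p q) →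
           (∀ {p q} → _≲_ Q p q → _≲_ P p q) → P ↝ Q
  same⇒↝ P Q P⇒Q Q⇒P e = _ , ε , ⇄-trans e (record
    { to      = λ c → c
    ; from    = λ c → c
    ; mono    = P⇒Q
    ; cancel  = Q⇒P
    ; to-from = λ _ → ≲-refl Q , ≲-refl Q
    })

  zipper⇒↝ : (P : DecidablePreorder C) → ∀ {x y z} → Zipper P x y z → P ↝ merge P x y z
  zipper⇒↝ P zipper e with ZipStep.zip-step P e zipper
  ... | _ , step , e′ = _ , step ◅ ε , e′

-- Collapsing the fibres of a preorder over a coarser one

module Collapse {C : Set} (Q : DecidablePreorder C) where
  private
    module Q = DecidablePreorder Q
  open DecidablePreorder
  open TopologicalSort Q.<-irrefl Q.<-trans Q._<?_

  Singleton : DecidablePreorder C → C → Set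
  Singleton P c = ∀ {d} → d Q.≈ c → _≈_ P d c

  record Triple (P : DecidablePreorder C) (c : C) : Set where
    field
      x y z  : C
      x≈c    : x Q.≈ c
      y≈c    : y Q.≈ c
      z≈c    : z Q.≈ c
      only   : ∀ {d} → d Q.≈ c → _≈_ P d x ⊎ _≈_ P d y ⊎ _≈_ P d z
      x≲z    : _≲_ P x z
      y≲z    : _≲_ P y z
      x≴y    : ¬ _≲_ P x y
      y≴x    : ¬ _≲_ P y x
      isJoin : ∀ {u} → _≲_ P x u → _≲_ P y u → _≲_ P z u

  -- `lift` is the abstract form of lifting a minor along the quotient map: the lower end may move
  -- within its fibre, while the upper end stays fixed.
  record Fibration (P : DecidablePreorder C) : Set where
    field
      coarser : ∀ {p q} → _≲_ P p q → p Q.≲ q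
      lift    : ∀ {p q} → p Q.≲ q → ∃[ p′ ] (p′ Q.≈ p × _≲_ P p′ q)

  Unfinished : DecidablePreorder C → List C → C → Set
  Unfinished P l c = Any (c Q.≈_) l × Triple P c

  module Step (P : DecidablePreorder C) (fib : Fibration P) (m : C) (l : List C)
              (sorted : Sorted (m ∷ l)) (fibres : ∀ c → Singleton P c ⊎ Unfinished P (m ∷ l) c)
              (triple : Triple P m) where
    private
      module P = DecidablePreorder P
    open Fibration fib
    open Triple triple

    -- An unfinished class has a representative in the list `m ∷ l`, and sortedness allows none
    -- strictly below `m`.
    smaller-singleton : ∀ {p} → p Q.< m → Singleton P p
    smaller-singleton {p} (p≲m , m≴p) with fibres p
    ... | inj₁ single = single
    ... | inj₂ (p∈ , _) = ⊥-elim (impossible sorted p∈)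
      where
      later : ∀ k → All (λ d → ¬ d Q.< m) k → ¬ Any (p Q.≈_) k
      later (d ∷ k) (d≮m ∷ _)  (here p≈d) =
        d≮m (Q.≲-trans (rhs≤lhs p≈d) p≲m , λ m≲d → m≴p (Q.≲-trans m≲d (rhs≤lhs p≈d)))
      later (d ∷ k) (_ ∷ k≮m) (there p∈′) = later k k≮m p∈′
      impossible : Sorted (m ∷ l) → ¬ Any (p Q.≈_) (m ∷ l)
      impossible _         (here p≈m) = m≴p (rhs≤lhs p≈m)
      impossible (l≮m ∷ _) (there p∈′) = later l l≮m p∈′

    -- The lift of `p ≲ q` starts in the fibre of `p`, which is a single point, so it starts at `p`
    -- up to equivalence.
    lift-below : ∀ {p q} → p Q.< m → m Q.≲ q → p P.≲ q
    lift-below p<m m≲q with lift (Q.≲-trans (proj₁ p<m) m≲q)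
    ... | p′ , p′≈p , p′≲q = P.≲-trans (rhs≤lhs (smaller-singleton p<m p′≈p)) p′≲q

    -- An element under `z` is either in the fibre of `m`, hence one of the three, or strictly below
    -- `m` in `Q`, where `lift-below` places it under both `x` and `y`.
    zipper : Zipper P x y z
    zipper = record
      { x≲z = x≲z ; y≲z = y≲z ; x≴y = x≴y ; y≴x = y≴x ; below = below ; isJoin = isJoin }
      where
      below : ∀ {p} → p P.≲ z → (p P.≈ x ⊎ p P.≈ y ⊎ p P.≈ z) ⊎ (p P.≲ x × p P.≲ y)
      below {p} p≲z with m Q.≲? p | Q.≲-trans (coarser p≲z) (lhs≤rhs z≈c)
      ... | yes m≲p | p≲m = inj₁ (only (p≲m , m≲p))
      ... | no  m≴p | p≲m = inj₂ (lift-below (p≲m , m≴p) (rhs≤lhs x≈c) ,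
                                  lift-below (p≲m , m≴p) (rhs≤lhs y≈c))

    P′ : DecidablePreorder C
    P′ = merge P x y z
    private
      module P′ = DecidablePreorder P′

    ≈⇒≈′ : ∀ {p q} → p P.≈ q → p P′.≈ q
    ≈⇒≈′ (p≲q , q≲p) = inj₁ p≲q , inj₁ q≲p

    fib′ : Fibration P′
    fib′ = record { coarser = coarser′ ; lift = lift′ }
      where
      coarser′ : ∀ {p q} → p P′.≲ q → p Q.≲ q
      coarser′ (inj₁ p≲q)              = coarser p≲q
      coarser′ (inj₂ (p≲z , inj₁ x≲q)) = Q.≲-trans (coarser p≲z)
        (Q.≲-trans (lhs≤rhs (Q.≈-trans z≈c (Q.≈-sym x≈c))) (coarser x≲q))
      coarser′ (inj₂ (p≲z , inj₂ y≲q)) = Q.≲-trans (coarser p≲z)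
        (Q.≲-trans (lhs≤rhs (Q.≈-trans z≈c (Q.≈-sym y≈c))) (coarser y≲q))
      lift′ : ∀ {p q} → p Q.≲ q → ∃[ p′ ] (p′ Q.≈ p × p′ P′.≲ q)
      lift′ p≲q with lift p≲q
      ... | p′ , p′≈p , p′≲q = p′ , p′≈p , inj₁ p′≲q

    merged : ∀ {d} → d Q.≈ m → d P′.≈ z
    merged d≈m with only d≈m
    ... | inj₁ d≈x        = P′.≈-trans (≈⇒≈′ d≈x) (inj₁ x≲z , inj₂ (P.≲-refl , inj₁ P.≲-refl))
    ... | inj₂ (inj₁ d≈y) = P′.≈-trans (≈⇒≈′ d≈y) (inj₁ y≲z , inj₂ (P.≲-refl , inj₂ P.≲-refl))
    ... | inj₂ (inj₂ d≈z) = ≈⇒≈′ d≈z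

    fibre-merged : ∀ {c} → c Q.≈ m → Singleton P′ c
    fibre-merged c≈m d≈c = P′.≈-trans (merged (Q.≈-trans d≈c c≈m)) (P′.≈-sym (merged c≈m))

    -- Within a triple other than the merged one nothing lies below z, since
    -- the fibres below m are singletons by the choice of m.
    Triple-preserved : ∀ {c} → ¬ c Q.≈ m → Triple P c → Triple P′ c
    Triple-preserved {c} c≉m t = record
      { x = T.x ; y = T.y ; z = T.z ; x≈c = T.x≈c ; y≈c = T.y≈c ; z≈c = T.z≈c
      ; only   = λ d≈c → only′ (T.only d≈c)
      ; x≲z    = inj₁ T.x≲z
      ; y≲z    = inj₁ T.y≲z
      ; x≴y    = λ { (inj₁ x≲y)       → T.x≴y x≲y
                   ; (inj₂ (x≲z , _)) → not-below T.x≈c x≲z }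
      ; y≴x    = λ { (inj₁ y≲x)       → T.y≴x y≲x
                   ; (inj₂ (y≲z , _)) → not-below T.y≈c y≲z }
      ; isJoin = λ
          { (inj₁ x≲u) (inj₁ y≲u)       → inj₁ (T.isJoin x≲u y≲u)
          ; (inj₂ (x≲z , _)) _          → ⊥-elim (not-below T.x≈c x≲z)
          ; (inj₁ _) (inj₂ (y≲z , _))   → ⊥-elim (not-below T.y≈c y≲z) }
      }
      where
      module T = Triple t
      only′ : ∀ {d} → d P.≈ T.x ⊎ d P.≈ T.y ⊎ d P.≈ T.z → d P′.≈ T.x ⊎ d P′.≈ T.y ⊎ d P′.≈ T.z
      only′ (inj₁ eq)        = inj₁ (≈⇒≈′ eq)
      only′ (inj₂ (inj₁ eq)) = inj₂ (inj₁ (≈⇒≈′ eq))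
      only′ (inj₂ (inj₂ eq)) = inj₂ (inj₂ (≈⇒≈′ eq))
      not-below : ∀ {d} → d Q.≈ c → ¬ d P.≲ z
      not-below d≈c d≲z = T.x≴y (lhs≤rhs
        (P.≈-trans (single T.x≈c) (P.≈-sym (single T.y≈c))))
        where
        c≲m : c Q.≲ m
        c≲m = Q.≲-trans (rhs≤lhs d≈c) (Q.≲-trans (coarser d≲z) (lhs≤rhs z≈c))
        single : Singleton P c
        single = smaller-singleton (c≲m , λ m≲c → c≉m (c≲m , m≲c))

    fibres′ : ∀ c → Singleton P′ c ⊎ Unfinished P′ l c
    fibres′ c with c Q.≈? m | fibres c
    ... | yes c≈m | _                       = inj₁ (fibre-merged c≈m)
    ... | no  _   | inj₁ single             = inj₁ (λ d≈c → ≈⇒≈′ (single d≈c))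
    ... | no  c≉m | inj₂ (here c≈m , _)     = contradiction c≈m c≉m
    ... | no  c≉m | inj₂ (there c∈ , t)     = inj₂ (c∈ , Triple-preserved c≉m t)

  collapse-sorted : ∀ l → Sorted l → ∀ P → Fibration P →
                    (∀ c → Singleton P c ⊎ Unfinished P l c) → P ↝ Q
  -- No triple is left, so all fibres are points and every relation of `Q` lifts to `P` without
  -- moving its lower end.
  collapse-sorted [] _ P fib fibres = same⇒↝ P Q coarser back
    where
    open Fibration fib
    back : ∀ {p q} → p Q.≲ q → _≲_ P p q
    back {p} p≲q with lift p≲q | fibres p
    ... | p′ , p′≈p , p′≲q | inj₁ single = ≲-trans P (rhs≤lhs (single p′≈p)) p′≲q
    ... | _                | inj₂ (() , _)
  collapse-sorted (m ∷ l) (m≮ ∷ s) P fib fibres with fibres m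
  ... | inj₂ (_ , t) =
    ↝-trans {P = P} {Q = P′} {R = Q} (zipper⇒↝ P zipper) (collapse-sorted l s P′ fib′ fibres′)
    where open Step P fib m l (m≮ ∷ s) fibres t
  ... | inj₁ single = collapse-sorted l s P fib λ c → skip (fibres c)
    where
    skip : ∀ {c} → Singleton P c ⊎ Unfinished P (m ∷ l) c → Singleton P c ⊎ Unfinished P l c
    skip (inj₁ single-c)         = inj₁ single-c
    skip (inj₂ (there c∈ , t))   = inj₂ (c∈ , t)
    skip (inj₂ (here c≈m , _))   = inj₁ λ d≈c →
      ≈-trans P (single (Q.≈-trans d≈c c≈m)) (≈-sym P (single c≈m))

  collapse : (l : List C) → (∀ c → c ∈ₗ l) → ∀ P → Fibration P →
             (∀ c → Singleton P c ⊎ Triple P c) → P ↝ Q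
  collapse l all∈ P fib fibres = collapse-sorted (sort l) (sort-sorted l) P fib λ c → add (fibres c)
    where
    add : ∀ {c} → Singleton P c ⊎ Triple P c → Singleton P c ⊎ Unfinished P (sort l) c
    add (inj₁ single) = inj₁ single
    add (inj₂ t)      =
      inj₂ (Any.map (λ { refl → Q.≲-refl , Q.≲-refl }) (∈-sort l (all∈ _)) , t)

-- Minors modulo a join-congruence

module _ {n : ℕ} {P : Fin n → Set} (P? : UnaryDecidable P) where

  collect : Subset n
  collect = tabulate (λ i → does (P? i))

  ∈-collect⁺ : ∀ {i} → P i → i ∈ collect
  ∈-collect⁺ {i} p = lookup⇒[]= i _ (trans (lookup∘tabulate _ i) (dec-true (P? i) p))

  ∈-collect⁻ : ∀ {i} → i ∈ collect → P i
  ∈-collect⁻ {i} i∈ with P? i | trans (sym (lookup∘tabulate (λ j → does (P? j)) i)) ([]=⇒lookup i∈)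
  ... | yes p | _ = p
  ... | no  _ | ()

subsets : ∀ n → List (Subset n)
subsets zero    = [] ∷ []
subsets (suc n) = map (true ∷_) (subsets n) ++ map (false ∷_) (subsets n)

∈-subsets : ∀ {n} (A : Subset n) → A ∈ₗ subsets n
∈-subsets []          = here refl
∈-subsets (true ∷ A)  = ∈-++⁺ˡ (∈-map⁺ (true ∷_) (∈-subsets A))
∈-subsets (false ∷ A) = ∈-++⁺ʳ (map (true ∷_) (subsets _)) (∈-map⁺ (false ∷_) (∈-subsets A))

module _ {L : Set} (_∨_ : L → L → L) (0̂ : L) where

  ⋁[_] : ∀ {n} → (Fin n → L) → Subset n → L
  ⋁[ γ ] []          = 0̂
  ⋁[ γ ] (true ∷ A)  = γ zero ∨ ⋁[ γ ∘ suc ] A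
  ⋁[ γ ] (false ∷ A) = ⋁[ γ ∘ suc ] A

  -- A join-semilattice up to its symmetric interior, that is, a join-congruence on L.
  record JoinPreorder : Set₁ where
    infix 4 _⊑_ _⊑?_ _~_
    field
      _⊑_    : Rel L 0ℓ
      ⊑-refl  : Reflexive _⊑_
      ⊑-trans : Transitive _⊑_
      _⊑?_    : Decidable _⊑_
      x⊑x∨y   : ∀ {x y} → x ⊑ x ∨ y
      y⊑x∨y   : ∀ {x y} → y ⊑ x ∨ y
      ∨-least : ∀ {x y u} → x ⊑ u → y ⊑ u → x ∨ y ⊑ u
      0̂-least : ∀ {x} → 0̂ ⊑ x

    _~_ : Rel L 0ℓ
    x ~ y = x ⊑ y × y ⊑ x

    _~?_ : Decidable _~_
    x ~? y = (x ⊑? y) ×-dec (y ⊑? x)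

    ~-sym : ∀ {x y} → x ~ y → y ~ x
    ~-sym (x⊑y , y⊑x) = y⊑x , x⊑y

    ~-trans : Transitive _~_
    ~-trans (x⊑y , y⊑x) (y⊑z , z⊑y) = ⊑-trans x⊑y y⊑z , ⊑-trans z⊑y y⊑x

    ∨-monoʳ : ∀ {x y z} → y ⊑ z → x ∨ y ⊑ x ∨ z
    ∨-monoʳ y⊑z = ∨-least x⊑x∨y (⊑-trans y⊑z y⊑x∨y)

    ⋁-upper : ∀ {n} (γ : Fin n → L) {A i} → i ∈ A → γ i ⊑ ⋁[ γ ] A
    ⋁-upper γ {true ∷ A}  here        = x⊑x∨y
    ⋁-upper γ {true ∷ A}  (there i∈A) = ⊑-trans (⋁-upper (γ ∘ suc) i∈A) y⊑x∨y
    ⋁-upper γ {false ∷ A} (there i∈A) = ⋁-upper (γ ∘ suc) i∈A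

    ⋁-least : ∀ {n} (γ : Fin n → L) {A u} → (∀ {i} → i ∈ A → γ i ⊑ u) → ⋁[ γ ] A ⊑ u
    ⋁-least γ {[]}        ⊑u = 0̂-least
    ⋁-least γ {true ∷ A}  ⊑u = ∨-least (⊑u here) (⋁-least (γ ∘ suc) (⊑u ∘ there))
    ⋁-least γ {false ∷ A} ⊑u = ⋁-least (γ ∘ suc) (⊑u ∘ there)

-- The preorder of encoded minors

module MinorPreorder {L : Set} (_∨_ : L → L → L) (0̂ : L) {n : ℕ} (γ : Fin n → L)
                     (S : JoinPreorder _∨_ 0̂) where
  open JoinPreorder S

  infix 4 _∼[_]_ _≼_ _≼?_

  -- The generators `i` and `j` become equal over `z`, that is, `γ i ∨ z` and `γ j ∨ z` are
  -- equivalent.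
  _∼[_]_ : Fin n → L → Fin n → Set
  i ∼[ z ] j = γ i ⊑ γ j ∨ z × γ j ⊑ γ i ∨ z

  ∼-refl : ∀ {i z} → i ∼[ z ] i
  ∼-refl = x⊑x∨y , x⊑x∨y

  ∼-sym : ∀ {i j z} → i ∼[ z ] j → j ∼[ z ] i
  ∼-sym (p , q) = q , p

  ⊑∨-trans : ∀ {i j k z} → γ i ⊑ γ j ∨ z → γ j ⊑ γ k ∨ z → γ i ⊑ γ k ∨ z
  ⊑∨-trans p q = ⊑-trans p (∨-least q y⊑x∨y)

  ∼-trans : ∀ {i j k z} → i ∼[ z ] j → j ∼[ z ] k → i ∼[ z ] k
  ∼-trans (p , p′) (q , q′) = ⊑∨-trans p q , ⊑∨-trans q′ p′

  ∼-mono : ∀ {i j z z′} → z ⊑ z′ → i ∼[ z ] j → i ∼[ z′ ] j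
  ∼-mono z⊑z′ (p , q) = ⊑-trans p (∨-monoʳ z⊑z′) , ⊑-trans q (∨-monoʳ z⊑z′)

  Covered : L → Fin n → Subset n → Set
  Covered z i B = γ i ⊑ z ⊎ ∃[ j ] (j ∈ B × i ∼[ z ] j)

  -- { γ i ∨ z : i ∈ A } ∖ { z } ⊆ { γ j ∨ z : j ∈ B } ∖ { z }
  Covers : L → Subset n → Subset n → Set
  Covers z A B = ∀ i → i ∈ A → Covered z i B

  Covers-⊆ : ∀ {z A B} → A ⊆ B → Covers z A B
  Covers-⊆ A⊆B i i∈A = inj₂ (i , A⊆B i∈A , ∼-refl)

  Covered-mono : ∀ {z z′ i B} → z ⊑ z′ → Covered z i B → Covered z′ i B
  Covered-mono z⊑z′ (inj₁ i⊑z)            = inj₁ (⊑-trans i⊑z z⊑z′)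
  Covered-mono z⊑z′ (inj₂ (j , j∈B , eq)) = inj₂ (j , j∈B , ∼-mono z⊑z′ eq)

  Covers-mono : ∀ {z z′ A B} → z ⊑ z′ → Covers z A B → Covers z′ A B
  Covers-mono z⊑z′ cov i i∈A = Covered-mono z⊑z′ (cov i i∈A)

  ∼-Covered : ∀ {z i j B} → i ∼[ z ] j → Covered z j B → Covered z i B
  ∼-Covered (i⊑j , _) (inj₁ j⊑z)           = inj₁ (⊑-trans i⊑j (∨-least j⊑z ⊑-refl))
  ∼-Covered i∼j       (inj₂ (k , k∈ , j∼k)) = inj₂ (k , k∈ , ∼-trans i∼j j∼k)

  Covers-trans : ∀ {z A B D} → Covers z A B → Covers z B D → Covers z A D
  Covers-trans cov cov′ i i∈A with cov i i∈A
  ... | inj₁ i⊑z            = inj₁ i⊑z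
  ... | inj₂ (j , j∈B , eq) = ∼-Covered eq (cov′ j j∈B)

  -- z′ = z ∨ ⋁ X for some X ⊆ { γ j : j ∈ A }
  Reaches : L → L → Subset n → Set
  Reaches z′ z A =
    z ⊑ z′ × (∀ u → z ⊑ u → (∀ j → j ∈ A → γ j ⊑ z′ → γ j ⊑ u) → z′ ⊑ u)

  reached? : ∀ z′ A → UnaryDecidable (λ j → j ∈ A × γ j ⊑ z′)
  reached? z′ A j = (j ∈? A) ×-dec (γ j ⊑? z′)

  -- The largest candidate for a contraction towards `z′`. Comparing `z′` with it replaces the
  -- quantification over all `u` in `Reaches`, which makes the relation decidable.
  joinReached : L → L → Subset n → L
  joinReached z′ z A = z ∨ ⋁[_] _∨_ 0̂ γ (collect (reached? z′ A))

  Reaches⇒⊑ : ∀ {z′ z A} → Reaches z′ z A → z′ ⊑ joinReached z′ z A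
  Reaches⇒⊑ {z′} {A = A} (_ , least) = least _ x⊑x∨y λ j j∈A j⊑z′ →
    ⊑-trans (⋁-upper γ (∈-collect⁺ (reached? z′ A) (j∈A , j⊑z′))) y⊑x∨y

  ⊑⇒Reaches : ∀ {z′ z A} → z ⊑ z′ → z′ ⊑ joinReached z′ z A → Reaches z′ z A
  ⊑⇒Reaches {z′} {A = A} z⊑z′ z′⊑ = z⊑z′ , λ u z⊑u reached →
    ⊑-trans z′⊑ (∨-least z⊑u (⋁-least γ λ {j} j∈ →
      let j∈A , j⊑z′ = ∈-collect⁻ (reached? z′ A) j∈ in reached j j∈A j⊑z′))

  -- (z , A) encodes the minor ⟨ { γ i ∨ z : i ∈ A } ∖ { z } ∣ z ⟩.
  _≼_ : Rel (L × Subset n) 0ℓ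
  (z′ , A′) ≼ (z , A) = Reaches z′ z A × Covers z′ A′ A

  ≼-intro : ∀ {z z′ A A′} → z′ ~ z → Covers z′ A′ A → (z′ , A′) ≼ (z , A)
  ≼-intro (z′⊑z , z⊑z′) cov = (z⊑z′ , λ u z⊑u _ → ⊑-trans z′⊑z z⊑u) , cov

  ≼-refl : Reflexive _≼_
  ≼-refl = ≼-intro (⊑-refl , ⊑-refl) (Covers-⊆ (λ i∈ → i∈))

  ≼-trans : Transitive _≼_
  ≼-trans {z″ , A″} {z′ , A′} {z , A} ((z′⊑z″ , least″) , cov″) ((z⊑z′ , least′) , cov′) =
    (⊑-trans z⊑z′ z′⊑z″ , least) , Covers-trans cov″ (Covers-mono z′⊑z″ cov′)
    where
    least : ∀ u → z ⊑ u → (∀ j → j ∈ A → γ j ⊑ z″ → γ j ⊑ u) → z″ ⊑ u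
    least u z⊑u reached = least″ u z′⊑u reached′
      where
      z′⊑u : z′ ⊑ u
      z′⊑u = least′ u z⊑u λ j j∈A j⊑z′ → reached j j∈A (⊑-trans j⊑z′ z′⊑z″)
      reached′ : ∀ i → i ∈ A′ → γ i ⊑ z″ → γ i ⊑ u
      reached′ i i∈A′ i⊑z″ with cov′ i i∈A′
      ... | inj₁ i⊑z′                  = ⊑-trans i⊑z′ z′⊑u
      -- `γ j` is also below `z″`, because `γ i` and `z′` are; hence the assumption on `u` applies
      -- to `j`.
      ... | inj₂ (j , j∈A , i⊑j , j⊑i) = ⊑-trans i⊑j (∨-least
        (reached j j∈A (⊑-trans j⊑i (∨-least i⊑z″ z′⊑z″))) z′⊑u)

  _≼?_ : Decidable _≼_
  (z′ , A′) ≼? (z , A) = reaches? ×-dec covers?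
    where
    reaches? : Dec (Reaches z′ z A)
    reaches? = map′ (λ (z⊑z′ , z′⊑) → ⊑⇒Reaches z⊑z′ z′⊑) (λ r → proj₁ r , Reaches⇒⊑ r)
                    ((z ⊑? z′) ×-dec (z′ ⊑? joinReached z′ z A))
    covers? : Dec (Covers z′ A′ A)
    covers? = Fin.all? λ i → (i ∈? A′) →-dec ((γ i ⊑? z′) ⊎-dec
      Fin.any? λ j → (j ∈? A) ×-dec ((γ i ⊑? γ j ∨ z′) ×-dec (γ j ⊑? γ i ∨ z′)))

  minors : DecidablePreorder ((L × Subset n) ₋)
  minors = record
    { _≲_     = AddInfimum._≤₋_ _≼_
    ; ≲-refl  = λ { {⊥₋} → AddInfimum.⊥₋≤ _ ; {[ p ]} → AddInfimum.[ ≼-refl ] }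
    ; ≲-trans = AddInfimum.≤₋-trans _≼_ ≼-trans
    ; _≲?_    = AddInfimum.≤₋-dec _≼_ _≼?_
    }

  Same : Rel (L × Subset n) 0ℓ
  Same (z , A) (z′ , A′) = z ~ z′ × Covers z A A′ × Covers z A′ A

  Same⇒≈ : ∀ {p q} → Same p q → DecidablePreorder._≈_ minors [ p ] [ q ]
  Same⇒≈ (z~z′ , cov , cov′) =
    AddInfimum.[ ≼-intro z~z′ cov ] , AddInfimum.[ ≼-intro (~-sym z~z′) (Covers-mono (proj₁ z~z′) cov′) ]

  ≈⇒Same : ∀ {p q} → DecidablePreorder._≈_ minors [ p ] [ q ] → Same p q
  ≈⇒Same (AddInfimum.[ (z′⊑z , _) , cov ] , AddInfimum.[ (z⊑z′ , _) , cov′ ]) =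
    (z⊑z′ , z′⊑z) , cov , Covers-mono z′⊑z cov′

-- Minors under a coarser join-congruence

module Coarsen {L : Set} (_∨_ : L → L → L) (0̂ : L) {n : ℕ} (γ : Fin n → L)
               (S S′ : JoinPreorder _∨_ 0̂) where
  private
    module S  = JoinPreorder S
    module S′ = JoinPreorder S′
    module M  = MinorPreorder _∨_ 0̂ γ S
    module M′ = MinorPreorder _∨_ 0̂ γ S′
  open S using (_⊑_; _~_)
  open S′ using () renaming (_⊑_ to _⊑′_; _~_ to _~′_)
  open Collapse M′.minors

  module _ (coarser : ∀ {x y} → x ⊑ y → x ⊑′ y) where

    ∼-coarser : ∀ {i j z} → i M.∼[ z ] j → i M′.∼[ z ] j
    ∼-coarser (p , q) = coarser p , coarser q

    Covered-coarser : ∀ {z i B} → M.Covered z i B → M′.Covered z i B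
    Covered-coarser (inj₁ i⊑z)             = inj₁ (coarser i⊑z)
    Covered-coarser (inj₂ (j , j∈B , i∼j)) = inj₂ (j , j∈B , ∼-coarser i∼j)

    Covers-coarser : ∀ {z A B} → M.Covers z A B → M′.Covers z A B
    Covers-coarser cov i i∈A = Covered-coarser (cov i i∈A)

    -- The universal form of `Reaches` refers to upper bounds for the finer relation, so it is
    -- transported through the explicit join `joinReached`.
    ≼-coarser : ∀ {p q} → p M.≼ q → p M′.≼ q
    ≼-coarser {z′ , _} {z , A} (reaches , cov) =
      (coarser (proj₁ reaches) , λ u z⊑u reached → S′.⊑-trans (coarser (M.Reaches⇒⊑ reaches))
        (S′.∨-least z⊑u (S′.⋁-least γ λ {j} j∈ →
          let j∈A , j⊑z′ = ∈-collect⁻ (M.reached? z′ A) j∈ in reached j j∈A (coarser j⊑z′)))) ,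
      Covers-coarser cov

    -- Minors lift along the quotient map by contracting and retaining the
    -- generators of the larger minor that represent those of the smaller one.
    ≼-lift : ∀ {p q} → p M′.≼ q → ∃[ p′ ] (M′.Same p′ p × p′ M.≼ q)
    ≼-lift {z′ , A′} {z , A} (reaches , cov) =
      (z₁ , A₁) ,
      ((S′.∨-least (proj₁ reaches) (S′.⋁-least γ (λ j∈ → proj₂ (∈-collect⁻ reached? j∈))) ,
        M′.Reaches⇒⊑ reaches) ,
       M′.Covers-mono z′⊑z₁ A₁-A′ , M′.Covers-mono z′⊑z₁ A′-A₁) ,
      ((S.x⊑x∨y , λ u z⊑u reached → S.∨-least z⊑u (S.⋁-least γ λ {j} j∈ →
         reached j (proj₁ (∈-collect⁻ reached? j∈)) (S.⊑-trans (S.⋁-upper γ j∈) S.y⊑x∨y))) ,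
       M.Covers-⊆ (λ j∈ → proj₁ (∈-collect⁻ represents? j∈)))
      where
      reached? = M′.reached? z′ A
      z₁ : L
      z₁ = M′.joinReached z′ z A
      z′⊑z₁ : z′ ⊑′ z₁
      z′⊑z₁ = M′.Reaches⇒⊑ reaches
      Represents : Fin n → Set
      Represents j = j ∈ A × ∃[ i ] (i ∈ A′ × i M′.∼[ z′ ] j)
      represents? : UnaryDecidable Represents
      represents? j = (j ∈? A) ×-dec Fin.any? λ i →
        (i ∈? A′) ×-dec ((γ i S′.⊑? γ j ∨ z′) ×-dec (γ j S′.⊑? γ i ∨ z′))
      A₁ : Subset n
      A₁ = collect represents?
      A₁-A′ : M′.Covers z′ A₁ A′
      A₁-A′ j j∈ with ∈-collect⁻ represents? j∈
      ... | _ , i , i∈A′ , i∼j = inj₂ (i , i∈A′ , M′.∼-sym i∼j)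
      A′-A₁ : M′.Covers z′ A′ A₁
      A′-A₁ i i∈A′ with cov i i∈A′
      ... | inj₁ i⊑z′            = inj₁ i⊑z′
      ... | inj₂ (j , j∈A , i∼j) =
        inj₂ (j , ∈-collect⁺ represents? (j∈A , i , i∈A′ , i∼j) , i∼j)

    fibration : Fibration M.minors
    fibration = record
      { coarser = λ { (AddInfimum.⊥₋≤ q) → AddInfimum.⊥₋≤ q
                    ; AddInfimum.[ p≼q ] → AddInfimum.[ ≼-coarser p≼q ] }
      ; lift    = lift
      }
      where
      open DecidablePreorder
      lift : ∀ {p q} → _≲_ M′.minors p q → ∃[ p′ ] (_≈_ M′.minors p′ p × _≲_ M.minors p′ q)
      lift (AddInfimum.⊥₋≤ q) = ⊥₋ , (AddInfimum.⊥₋≤ ⊥₋ , AddInfimum.⊥₋≤ ⊥₋) , AddInfimum.⊥₋≤ q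
      lift AddInfimum.[ p≼q ] with ≼-lift p≼q
      ... | p′ , same , p′≼q = [ p′ ] , M′.Same⇒≈ same , AddInfimum.[ p′≼q ]

    -- S′ is obtained from S by identifying a with its only upper cover b.
    module Elementary (a b : L) (b⊑′a : b ⊑′ a)
                      (only : ∀ {x y} → x ⊑′ y → x ⊑ y ⊎ (x ⊑ b × y ~ a))
                      (a⊑b : a ⊑ b) (b⋢a : ¬ b ⊑ a)
                      (covers-a : ∀ {x} → a ⊑ x → x ⊑ a ⊎ b ⊑ x)
                      (g : Fin n) (g⊑b : γ g ⊑ b) (g⋢a : ¬ γ g ⊑ a) where

      -- All new relations end in the class of `a`; a relation with any other target was there
      -- before.
      reflects : ∀ {x y} → ¬ y ~ a → x ⊑′ y → x ⊑ y
      reflects y≁a x⊑′y with only x⊑′y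
      ... | inj₁ x⊑y       = x⊑y
      ... | inj₂ (_ , y~a) = contradiction y~a y≁a

      reflects-b : ∀ {x y} → b ⊑ y → x ⊑′ y → x ⊑ y
      reflects-b b⊑y = reflects λ (y⊑a , _) → b⋢a (S.⊑-trans b⊑y y⊑a)

      b~′a : b ~′ a
      b~′a = b⊑′a , coarser a⊑b

      -- What is above `a` is below `a` or above `b` by `covers-a`, so the merged class splits into
      -- just the two old classes.
      class-a : ∀ {y} → y ~′ a → y ~ a ⊎ y ~ b
      class-a {y} (y⊑′a , a⊑′y) with only a⊑′y
      ... | inj₂ (_ , y~a) = inj₁ y~a
      ... | inj₁ a⊑y with covers-a a⊑y
      ...   | inj₁ y⊑a = inj₁ (y⊑a , a⊑y)
      ...   | inj₂ b⊑y with only y⊑′a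
      ...     | inj₁ y⊑a       = inj₂ (S.⊑-trans y⊑a a⊑b , b⊑y)
      ...     | inj₂ (y⊑b , _) = inj₂ (y⊑b , b⊑y)

      a-class : ∀ {y} → y ~ a ⊎ y ~ b → y ~′ a
      a-class (inj₁ (y⊑a , a⊑y)) = coarser y⊑a , coarser a⊑y
      a-class (inj₂ (y⊑b , b⊑y)) = S′.~-trans (coarser y⊑b , coarser b⊑y) b~′a

      -- Any proper step up from `a` passes `b`. In particular `γ g ∨ a` is equivalent to `b`, so
      -- over `a` the index `g` stands for the generator `b`.
      ⊑a∨ : ∀ {k} → ¬ γ k ⊑ a → b ⊑ γ k ∨ a
      ⊑a∨ k⋢a with covers-a S.y⊑x∨y
      ... | inj₁ k∨a⊑a = contradiction (S.⊑-trans S.x⊑x∨y k∨a⊑a) k⋢a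
      ... | inj₂ b⊑k∨a = b⊑k∨a

      record Fibre (z : L) (A : Subset n) : Set where
        field
          x y t  : L × Subset n
          x≈c    : M′.Same x (z , A)
          y≈c    : M′.Same y (z , A)
          t≈c    : M′.Same t (z , A)
          classify : ∀ {d} → M′.Same d (z , A) → M.Same d x ⊎ M.Same d y ⊎ M.Same d t
          x≼t    : x M.≼ t
          y≼t    : y M.≼ t
          x⋠y    : ¬ x M.≼ y
          y⋠x    : ¬ y M.≼ x
          isJoin : ∀ {u} → x M.≼ u → y M.≼ u → t M.≼ u

      -- Fibres of minors whose minimum lies in the merged class

      module AtMerged (z : L) (A : Subset n) (z~′a : z ~′ a) where

        z~′b : z ~′ b
        z~′b = S′.~-trans z~′a (S′.~-sym b~′a)

        -- Generators below `b` vanish over `b`, and over `a` they vanish or become `b`. They are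
        -- left out of `B`, and adding `g` records the second possibility.
        retained? : UnaryDecidable (λ i → i ∈ A × ¬ γ i ⊑ b)
        retained? i = (i ∈? A) ×-dec ¬? (γ i S.⊑? b)

        B : Subset n
        B = collect retained?

        B⁻ : ∀ {i} → i ∈ B → i ∈ A × ¬ γ i ⊑ b
        B⁻ = ∈-collect⁻ retained?

        B∪g : Subset n
        B∪g = B ∪ ⁅ g ⁆

        B⊆B∪g : B ⊆ B∪g
        B⊆B∪g i∈B = x∈p∪q⁺ (inj₁ i∈B)

        g∈B∪g : g ∈ B∪g
        g∈B∪g = x∈p∪q⁺ (inj₂ (x∈⁅x⁆ g))

        -- Above `b` the two congruences agree, so the members of the fibre are compared over `b`
        -- first and the result is brought down to `a` afterwards.
        Covers-b : ∀ {A B} → M′.Covers b A B → M.Covers b A B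
        Covers-b cov i i∈A with cov i i∈A
        ... | inj₁ i⊑b                   = inj₁ (reflects-b S.⊑-refl i⊑b)
        ... | inj₂ (j , j∈B , i⊑j , j⊑i) =
          inj₂ (j , j∈B , reflects-b S.y⊑x∨y i⊑j , reflects-b S.y⊑x∨y j⊑i)

        A-B : M.Covers b A B
        A-B i i∈A with γ i S.⊑? b
        ... | yes i⊑b = inj₁ i⊑b
        ... | no  i⋢b = inj₂ (i , ∈-collect⁺ retained? (i∈A , i⋢b) , M.∼-refl)

        B-A : M.Covers b B A
        B-A = M.Covers-⊆ (λ i∈ → proj₁ (B⁻ i∈))

        B∪g-A : M.Covers b B∪g A
        B∪g-A i i∈ with x∈p∪q⁻ B ⁅ g ⁆ i∈
        ... | inj₁ i∈B = B-A i i∈B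
        ... | inj₂ i∈g with x∈⁅y⁆⇒x≡y g i∈g
        ...   | refl = inj₁ g⊑b

        into-fibre : ∀ {w D} → w ~′ a → M.Covers b D A → M.Covers b A D → M′.Same (w , D) (z , A)
        into-fibre w~′a D-A A-D =
          S′.~-trans w~′a (S′.~-sym z~′a) ,
          M′.Covers-mono b⊑′w (Covers-coarser D-A) , M′.Covers-mono b⊑′w (Covers-coarser A-D)
          where b⊑′w = proj₂ (S′.~-trans w~′a (S′.~-sym b~′a))

        -- A generator that is not below `b` is not below `a`, so its join with `a` already contains
        -- `b` and enlarging `a` to `b` adds nothing.
        b-to-a : ∀ {i j} → ¬ γ i ⊑ b → ¬ γ j ⊑ b → i M.∼[ b ] j → i M.∼[ a ] j
        b-to-a i⋢b j⋢b (i⊑j , j⊑i) =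
          S.⊑-trans i⊑j (S.∨-least S.x⊑x∨y (⊑a∨ (λ j⊑a → j⋢b (S.⊑-trans j⊑a a⊑b)))) ,
          S.⊑-trans j⊑i (S.∨-least S.x⊑x∨y (⊑a∨ (λ i⊑a → i⋢b (S.⊑-trans i⊑a a⊑b))))

        Covered-b-to-a : ∀ {i D} → ¬ γ i ⊑ b → M.Covered b i D → M.Covered a i D
        Covered-b-to-a i⋢b (inj₁ i⊑b)             = contradiction i⊑b i⋢b
        Covered-b-to-a i⋢b (inj₂ (j , j∈D , i∼j)) = inj₂ (j , j∈D , b-to-a i⋢b j⋢b i∼j)
          where j⋢b = λ j⊑b → i⋢b (S.⊑-trans (proj₁ i∼j) (S.∨-least j⊑b S.⊑-refl))

        atoms-∼ : ∀ {i j} → γ i ⊑ b → ¬ γ i ⊑ a → γ j ⊑ b → ¬ γ j ⊑ a → i M.∼[ a ] j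
        atoms-∼ i⊑b i⋢a j⊑b j⋢a = S.⊑-trans i⊑b (⊑a∨ j⋢a) , S.⊑-trans j⊑b (⊑a∨ i⋢a)

        -- By `atoms-∼` all such generators coincide over `a`, so only the existence of one matters.
        -- It separates `(a , B)` from `(a , B∪g)`.
        atom? : ∀ D → Dec (∃[ k ] (k ∈ D × γ k ⊑ b × ¬ γ k ⊑ a))
        atom? D = Fin.any? λ k → (k ∈? D) ×-dec ((γ k S.⊑? b) ×-dec ¬? (γ k S.⊑? a))

        module _ {w D} (same : M′.Same (w , D) (z , A)) where

          w⊑′b : w ⊑′ b
          w⊑′b = proj₁ (S′.~-trans (proj₁ same) z~′b)

          D-B : M.Covers b D B
          D-B = M.Covers-trans (Covers-b (M′.Covers-mono w⊑′b (proj₁ (proj₂ same)))) A-B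

          B-D : M.Covers b B D
          B-D = M.Covers-trans B-A (Covers-b (M′.Covers-mono w⊑′b (proj₂ (proj₂ same))))

        classify : ∀ {d} → M′.Same d (z , A) →
                   M.Same d (a , B) ⊎ M.Same d (b , B) ⊎ M.Same d (a , B∪g)
        classify {w , D} same@(w~′z , _) with class-a (S′.~-trans w~′z z~′a) | atom? D
        ... | inj₂ w~b | _ = inj₂ (inj₁
          (w~b , M.Covers-mono (proj₂ w~b) (D-B same) , M.Covers-mono (proj₂ w~b) (B-D same)))
        ... | inj₁ w~a | atom = result atom
          where
          a⊑w = proj₂ w~a
          B-D-a : M.Covers a B D
          B-D-a i i∈B = Covered-b-to-a (proj₂ (B⁻ i∈B)) (B-D same i i∈B)
          result : Dec (∃[ k ] (k ∈ D × γ k ⊑ b × ¬ γ k ⊑ a)) →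
                   M.Same (w , D) (a , B) ⊎ M.Same (w , D) (b , B) ⊎ M.Same (w , D) (a , B∪g)
          result (no no-atom) = inj₁ (w~a , M.Covers-mono a⊑w D-B-a , M.Covers-mono a⊑w B-D-a)
            where
            D-B-a : M.Covers a D B
            D-B-a i i∈D with γ i S.⊑? a | γ i S.⊑? b
            ... | yes i⊑a | _       = inj₁ i⊑a
            ... | no  i⋢a | yes i⊑b = contradiction (i , i∈D , i⊑b , i⋢a) no-atom
            ... | no  _   | no  i⋢b = Covered-b-to-a i⋢b (D-B same i i∈D)
          result (yes (k , k∈D , k⊑b , k⋢a)) =
            inj₂ (inj₂ (w~a , M.Covers-mono a⊑w D-B∪g , M.Covers-mono a⊑w B∪g-D))
            where
            D-B∪g : M.Covers a D B∪g
            D-B∪g i i∈D with γ i S.⊑? a | γ i S.⊑? b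
            ... | yes i⊑a | _       = inj₁ i⊑a
            ... | no  i⋢a | yes i⊑b = inj₂ (g , g∈B∪g , atoms-∼ i⊑b i⋢a g⊑b g⋢a)
            ... | no  _   | no  i⋢b =
              Covered-b-to-a i⋢b (M.Covers-trans (D-B same) (M.Covers-⊆ B⊆B∪g) i i∈D)
            B∪g-D : M.Covers a B∪g D
            B∪g-D i i∈ with x∈p∪q⁻ B ⁅ g ⁆ i∈
            ... | inj₁ i∈B = B-D-a i i∈B
            ... | inj₂ i∈g with x∈⁅y⁆⇒x≡y g i∈g
            ...   | refl = inj₂ (k , k∈D , atoms-∼ g⊑b g⋢a k⊑b k⋢a)

        -- The first assumption reaches `a` and covers `B`. The second reaches `b`, which forces `D`
        -- to have a generator below `b` but not below `a`: otherwise all that is used to reach `b`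
        -- would be below `a`. That generator covers `g`.
        isJoin : ∀ {u} → (a , B) M.≼ u → (b , B) M.≼ u → (a , B∪g) M.≼ u
        isJoin {s , D} (reaches , B-D) ((s⊑b , least-b) , _) = reaches , B∪g-D
          where
          B∪g-D : M.Covers a B∪g D
          B∪g-D i i∈ with x∈p∪q⁻ B ⁅ g ⁆ i∈
          ... | inj₁ i∈B = B-D i i∈B
          ... | inj₂ i∈g with x∈⁅y⁆⇒x≡y g i∈g | atom? D
          ...   | refl | yes (k , k∈D , k⊑b , k⋢a) = inj₂ (k , k∈D , atoms-∼ g⊑b g⋢a k⊑b k⋢a)
          ...   | refl | no no-atom = contradiction (least-b a (proj₁ reaches) below-a) b⋢a
            where
            below-a : ∀ j → j ∈ D → γ j ⊑ b → γ j ⊑ a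
            below-a j j∈D j⊑b with γ j S.⊑? a
            ... | yes j⊑a = j⊑a
            ... | no  j⋢a = contradiction (j , j∈D , j⊑b , j⋢a) no-atom

        fibre : Fibre z A
        fibre = record
          { x = a , B ; y = b , B ; t = a , B∪g
          ; x≈c      = into-fibre (S′.⊑-refl , S′.⊑-refl) B-A A-B
          ; y≈c      = into-fibre b~′a B-A A-B
          ; t≈c      = into-fibre (S′.⊑-refl , S′.⊑-refl) B∪g-A
                         (M.Covers-trans A-B (M.Covers-⊆ B⊆B∪g))
          ; classify = classify
          ; x≼t      = M.≼-intro (S.⊑-refl , S.⊑-refl) (M.Covers-⊆ B⊆B∪g)
          ; y≼t      = (a⊑b , λ u a⊑u reached → b⊑ a⊑u (reached g g∈B∪g g⊑b)) , M.Covers-⊆ B⊆B∪g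
          ; x⋠y      = λ ((b⊑a , _) , _) → b⋢a b⊑a
          -- `B` has no generator below `b`, so contraction inside `(a , B)` cannot reach `b`.
          ; y⋠x      = λ ((_ , least) , _) → b⋢a (least a S.⊑-refl λ j j∈B j⊑b →
                         contradiction j⊑b (proj₂ (B⁻ j∈B)))
          ; isJoin   = isJoin
          }
          where
          b⊑ : ∀ {u} → a ⊑ u → γ g ⊑ u → b ⊑ u
          b⊑ a⊑u g⊑u = S.⊑-trans (⊑a∨ g⋢a) (S.∨-least g⊑u a⊑u)

      -- Fibres of minors whose minimum lies outside the merged class

      module AwayFromMerged (z : L) (A : Subset n) (z≁′a : ¬ z ~′ a) where

        -- The minimum `z` is unaffected here, so only the generators that land in the merged class
        -- over `z` matter; `Ka` and `Kb` tell its two halves apart.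
        K Ka Kb : Fin n → Set
        K i  = (γ i ∨ z) ~′ a
        Ka i = (γ i ∨ z) ~ a
        Kb i = (γ i ∨ z) ~ b

        z≁a : ¬ z ~ a
        z≁a z~a = z≁′a (a-class (inj₁ z~a))

        reflects-z : ∀ {w} → w ~′ z → w ~ z
        reflects-z (w⊑z , z⊑w) = reflects z≁a w⊑z ,
          reflects (λ w~a → z≁′a (S′.~-trans (z⊑w , w⊑z) (a-class (inj₁ w~a)))) z⊑w

        K⇒⋢ : ∀ {i} → K i → ¬ γ i ⊑′ z
        K⇒⋢ (i∨z⊑a , a⊑i∨z) i⊑z = z≁′a
          (S′.⊑-trans S′.y⊑x∨y i∨z⊑a , S′.⊑-trans a⊑i∨z (S′.∨-least i⊑z S′.⊑-refl))

        K-resp : ∀ {i j} → i M′.∼[ z ] j → K i → K j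
        K-resp (i⊑j , j⊑i) (i∨z⊑a , a⊑i∨z) =
          S′.⊑-trans (S′.∨-least j⊑i S′.y⊑x∨y) i∨z⊑a ,
          S′.⊑-trans a⊑i∨z (S′.∨-least i⊑j S′.y⊑x∨y)

        same-class : ∀ {i j c} → (γ i ∨ z) ~ c → (γ j ∨ z) ~ c → i M.∼[ z ] j
        same-class (i⊑c , c⊑i) (j⊑c , c⊑j) =
          S.⊑-trans S.x⊑x∨y (S.⊑-trans i⊑c c⊑j) , S.⊑-trans S.x⊑x∨y (S.⊑-trans j⊑c c⊑i)

        K-∼′ : ∀ {i j} → K i → K j → i M′.∼[ z ] j
        K-∼′ (i⊑a , a⊑i) (j⊑a , a⊑j) =
          S′.⊑-trans S′.x⊑x∨y (S′.⊑-trans i⊑a a⊑j) , S′.⊑-trans S′.x⊑x∨y (S′.⊑-trans j⊑a a⊑i)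

        -- `K` is invariant under equality over `z` in the coarser sense, so neither `γ i ∨ z` nor
        -- `γ j ∨ z` is in the class of `a`, where all new relations end.
        reflects-∼ : ∀ {i j} → ¬ K i → i M′.∼[ z ] j → i M.∼[ z ] j
        reflects-∼ ¬Ki i∼j =
          reflects (λ j~a → ¬Ki (K-resp (M′.∼-sym i∼j) (a-class (inj₁ j~a)))) (proj₁ i∼j) ,
          reflects (λ i~a → ¬Ki (a-class (inj₁ i~a))) (proj₂ i∼j)

        K? : UnaryDecidable K
        K? i = (γ i ∨ z) S′.~? a

        Covers-strict : ∀ {D D′} → M′.Covers z D D′ →
                        (∀ {i j} → i ∈ D → j ∈ D′ → K i → K j → i M.∼[ z ] j) → M.Covers z D D′
        Covers-strict cov both i i∈D with cov i i∈D | K? i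
        ... | inj₁ i⊑z             | _      = inj₁ (reflects z≁a i⊑z)
        ... | inj₂ (j , j∈ , i∼j) | no ¬Ki = inj₂ (j , j∈ , reflects-∼ ¬Ki i∼j)
        ... | inj₂ (j , j∈ , i∼j) | yes Ki = inj₂ (j , j∈ , both i∈D j∈ Ki (K-resp i∼j Ki))

        -- Only two generators in `K` can be newly identified. Each comparison of `D` with `A`
        -- involves one index from `A`, so the assumption is restricted to such pairs and becomes
        -- vacuous when `A` does not meet `K`.
        singleton : (∀ {i j} → i ∈ A ⊎ j ∈ A → K i → K j → i M.∼[ z ] j) →
                    ∀ {d} → M′.Same d (z , A) → M.Same d (z , A)
        singleton both (w~z , D-A , A-D) = w~ ,
          M.Covers-mono (proj₂ w~) (Covers-strict (M′.Covers-mono (proj₁ w~z) D-A) (λ _ j∈A → both (inj₂ j∈A))) ,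
          M.Covers-mono (proj₂ w~) (Covers-strict (M′.Covers-mono (proj₁ w~z) A-D) (λ i∈A _ → both (inj₁ i∈A)))
          where w~ = reflects-z w~z

        -- By `K-∼′` the generators in `K` form one generator in the coarser sense, so those of `A`
        -- may be exchanged for any nonempty set `U` of others from `K`.
        retained? : UnaryDecidable (λ i → i ∈ A × ¬ K i)
        retained? i = (i ∈? A) ×-dec ¬? (K? i)

        B : Subset n
        B = collect retained?

        B⁻ : ∀ {i} → i ∈ B → i ∈ A × ¬ K i
        B⁻ = ∈-collect⁻ retained?

        B⊆B∪ : ∀ {U} → B ⊆ B ∪ U
        B⊆B∪ i∈B = x∈p∪q⁺ (inj₁ i∈B)

        U⊆B∪ : ∀ {U} → U ⊆ B ∪ U
        U⊆B∪ i∈U = x∈p∪q⁺ (inj₂ i∈U)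

        into-fibre : ∀ {U k m} → k ∈ A → K k → m ∈ U → K m → (∀ {i} → i ∈ U → K i) →
                     M′.Same (z , B ∪ U) (z , A)
        into-fibre {U} {k} {m} k∈A Kk m∈U Km KU = (S′.⊑-refl , S′.⊑-refl) , to-A , from-A
          where
          to-A : M′.Covers z (B ∪ U) A
          to-A i i∈ with x∈p∪q⁻ B U i∈
          ... | inj₁ i∈B = inj₂ (i , proj₁ (B⁻ i∈B) , M′.∼-refl)
          ... | inj₂ i∈U = inj₂ (k , k∈A , K-∼′ (KU i∈U) Kk)
          from-A : M′.Covers z A (B ∪ U)
          from-A i i∈A with K? i
          ... | yes Ki = inj₂ (m , U⊆B∪ m∈U , K-∼′ Ki Km)
          ... | no ¬Ki = inj₂ (i , B⊆B∪ (∈-collect⁺ retained? (i∈A , ¬Ki)) , M′.∼-refl)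

        out-of-fibre : ∀ {w D U} → M′.Same (w , D) (z , A) →
                       (∀ {i} → i ∈ D → K i → ∃[ j ] (j ∈ U × i M.∼[ z ] j)) →
                       (∀ {j} → j ∈ U → ∃[ i ] (i ∈ D × j M.∼[ z ] i)) →
                       M.Same (w , D) (z , B ∪ U)
        out-of-fibre {w} {D} {U} (w~′z , D-A , A-D) D-U U-D =
          w~z , M.Covers-mono (proj₂ w~z) to-B∪U , M.Covers-mono (proj₂ w~z) from-B∪U
          where
          w~z = reflects-z w~′z
          to-B∪U : M.Covers z D (B ∪ U)
          to-B∪U i i∈D with K? i
          ... | yes Ki = let j , j∈U , i∼j = D-U i∈D Ki in inj₂ (j , U⊆B∪ j∈U , i∼j)
          ... | no ¬Ki with M′.Covers-mono (proj₁ w~′z) D-A i i∈D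
          ...   | inj₁ i⊑z = inj₁ (reflects z≁a i⊑z)
          ...   | inj₂ (j , j∈A , i∼j) = inj₂
                (j , B⊆B∪ (∈-collect⁺ retained? (j∈A , λ Kj → ¬Ki (K-resp (M′.∼-sym i∼j) Kj))) ,
                 reflects-∼ ¬Ki i∼j)
          from-B∪U : M.Covers z (B ∪ U) D
          from-B∪U i i∈ with x∈p∪q⁻ B U i∈
          ... | inj₂ i∈U = inj₂ (U-D i∈U)
          ... | inj₁ i∈B with M′.Covers-mono (proj₁ w~′z) A-D i (proj₁ (B⁻ i∈B))
          ...   | inj₁ i⊑z             = inj₁ (reflects z≁a i⊑z)
          ...   | inj₂ (j , j∈D , i∼j) = inj₂ (j , j∈D , reflects-∼ (proj₂ (B⁻ i∈B)) i∼j)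

        -- `k` witnesses that `A` meets `K`. The representatives `i` and `j` of the two halves may
        -- come from outside `A`.
        module _ {k i j : Fin n} (k∈A : k ∈ A) (Kk : K k) (Kai : Ka i) (Kbj : Kb j) where

          Ki : K i
          Ki = a-class (inj₁ Kai)

          Kj : K j
          Kj = a-class (inj₂ Kbj)

          i≁j : ¬ i M.∼[ z ] j
          i≁j (_ , j⊑i) = b⋢a (S.⊑-trans (proj₂ Kbj)
            (S.⊑-trans (S.∨-least j⊑i S.y⊑x∨y) (proj₁ Kai)))

          in-singleton : ∀ {P : Fin n → Set} {m} → P m → ∀ {l} → l ∈ ⁅ m ⁆ → P l
          in-singleton {m = m} Pm l∈ with x∈⁅y⁆⇒x≡y m l∈
          ... | refl = Pm

          in-pair : ∀ {P : Fin n → Set} → P i → P j → ∀ {l} → l ∈ ⁅ i ⁆ ∪ ⁅ j ⁆ → P l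
          in-pair {P} Pi Pj l∈ with x∈p∪q⁻ ⁅ i ⁆ ⁅ j ⁆ l∈
          ... | inj₁ l∈i = in-singleton {P} Pi l∈i
          ... | inj₂ l∈j = in-singleton {P} Pj l∈j

          i∈pair : i ∈ ⁅ i ⁆ ∪ ⁅ j ⁆
          i∈pair = x∈p∪q⁺ (inj₁ (x∈⁅x⁆ i))

          j∈pair : j ∈ ⁅ i ⁆ ∪ ⁅ j ⁆
          j∈pair = x∈p∪q⁺ (inj₂ (x∈⁅x⁆ j))

          classify : ∀ {d} → M′.Same d (z , A) →
                     M.Same d (z , B ∪ ⁅ i ⁆) ⊎ M.Same d (z , B ∪ ⁅ j ⁆) ⊎
                     M.Same d (z , B ∪ (⁅ i ⁆ ∪ ⁅ j ⁆))
          classify {w , D} same@(w~′z , _ , A-D) with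
            Fin.any? (λ l → (l ∈? D) ×-dec ((γ l ∨ z) S.~? a)) |
            Fin.any? (λ l → (l ∈? D) ×-dec ((γ l ∨ z) S.~? b))
          ... | yes (p , p∈D , Kap) | yes (q , q∈D , Kbq) = inj₂ (inj₂ (out-of-fibre same D-U
                (in-pair {λ m → ∃[ l ] (l ∈ D × m M.∼[ z ] l)}
                  (p , p∈D , same-class Kai Kap) (q , q∈D , same-class Kbj Kbq))))
            where
            D-U : ∀ {l} → l ∈ D → K l → ∃[ m ] (m ∈ ⁅ i ⁆ ∪ ⁅ j ⁆ × l M.∼[ z ] m)
            D-U l∈D Kl with class-a Kl
            ... | inj₁ Kal = i , i∈pair , same-class Kal Kai
            ... | inj₂ Kbl = j , j∈pair , same-class Kbl Kbj
          ... | yes (p , p∈D , Kap) | no ¬Kb = inj₁ (out-of-fibre same D-U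
                (in-singleton {λ m → ∃[ l ] (l ∈ D × m M.∼[ z ] l)} (p , p∈D , same-class Kai Kap)))
            where
            D-U : ∀ {l} → l ∈ D → K l → ∃[ m ] (m ∈ ⁅ i ⁆ × l M.∼[ z ] m)
            D-U l∈D Kl with class-a Kl
            ... | inj₁ Kal = i , x∈⁅x⁆ i , same-class Kal Kai
            ... | inj₂ Kbl = contradiction (_ , l∈D , Kbl) ¬Kb
          ... | no ¬Ka | yes (q , q∈D , Kbq) = inj₂ (inj₁ (out-of-fibre same D-U
                (in-singleton {λ m → ∃[ l ] (l ∈ D × m M.∼[ z ] l)} (q , q∈D , same-class Kbj Kbq))))
            where
            D-U : ∀ {l} → l ∈ D → K l → ∃[ m ] (m ∈ ⁅ j ⁆ × l M.∼[ z ] m)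
            D-U l∈D Kl with class-a Kl
            ... | inj₁ Kal = contradiction (_ , l∈D , Kal) ¬Ka
            ... | inj₂ Kbl = j , x∈⁅x⁆ j , same-class Kbl Kbj
          -- `D` cannot avoid both halves: it has to cover `k`, and the covering generator is again
          -- in `K`.
          ... | no ¬Ka | no ¬Kb with M′.Covers-mono (proj₁ w~′z) A-D k k∈A
          ...   | inj₁ k⊑z = contradiction k⊑z (K⇒⋢ Kk)
          ...   | inj₂ (l , l∈D , k∼l) with class-a (K-resp k∼l Kk)
          ...     | inj₁ Kal = contradiction (l , l∈D , Kal) ¬Ka
          ...     | inj₂ Kbl = contradiction (l , l∈D , Kbl) ¬Kb

          -- `B` contains nothing from `K`, so `p` could only be covered by `q`, from which it
          -- differs over `z`.
          incomparable : ∀ {p q} → K p → K q → ¬ p M.∼[ z ] q → ¬ (z , B ∪ ⁅ p ⁆) M.≼ (z , B ∪ ⁅ q ⁆)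
          incomparable {p} {q} Kp Kq p≁q (_ , cov) with cov p (U⊆B∪ (x∈⁅x⁆ p))
          ... | inj₁ p⊑z = K⇒⋢ Kp (coarser p⊑z)
          ... | inj₂ (l , l∈ , p∼l) with x∈p∪q⁻ B ⁅ q ⁆ l∈
          ...   | inj₁ l∈B = proj₂ (B⁻ l∈B) (K-resp (∼-coarser p∼l) Kp)
          ...   | inj₂ l∈q with x∈⁅y⁆⇒x≡y q l∈q
          ...     | refl = p≁q p∼l

          isJoin : ∀ {u} → (z , B ∪ ⁅ i ⁆) M.≼ u → (z , B ∪ ⁅ j ⁆) M.≼ u →
                   (z , B ∪ (⁅ i ⁆ ∪ ⁅ j ⁆)) M.≼ u
          isJoin {s , D} (reaches , cov-i) (_ , cov-j) = reaches , cov
            where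
            cov : M.Covers z (B ∪ (⁅ i ⁆ ∪ ⁅ j ⁆)) D
            cov l l∈ with x∈p∪q⁻ B (⁅ i ⁆ ∪ ⁅ j ⁆) l∈
            ... | inj₁ l∈B = cov-i l (B⊆B∪ l∈B)
            ... | inj₂ l∈ij = in-pair {λ m → M.Covered z m D}
              (cov-i i (U⊆B∪ (x∈⁅x⁆ i))) (cov-j j (U⊆B∪ (x∈⁅x⁆ j))) l∈ij

          ∪-monoʳ : ∀ {U V} → U ⊆ V → B ∪ U ⊆ B ∪ V
          ∪-monoʳ {U} U⊆V l∈ with x∈p∪q⁻ B U l∈
          ... | inj₁ l∈B = B⊆B∪ l∈B
          ... | inj₂ l∈U = U⊆B∪ (U⊆V l∈U)

          fibre : Fibre z A
          fibre = record
            { x = z , B ∪ ⁅ i ⁆ ; y = z , B ∪ ⁅ j ⁆ ; t = z , B ∪ (⁅ i ⁆ ∪ ⁅ j ⁆)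
            ; x≈c      = into-fibre k∈A Kk (x∈⁅x⁆ i) Ki (in-singleton {K} Ki)
            ; y≈c      = into-fibre k∈A Kk (x∈⁅x⁆ j) Kj (in-singleton {K} Kj)
            ; t≈c      = into-fibre k∈A Kk i∈pair Ki (in-pair {K} Ki Kj)
            ; classify = classify
            ; x≼t      = M.≼-intro (S.⊑-refl , S.⊑-refl)
                           (M.Covers-⊆ (∪-monoʳ (λ l∈ → x∈p∪q⁺ (inj₁ l∈))))
            ; y≼t      = M.≼-intro (S.⊑-refl , S.⊑-refl)
                           (M.Covers-⊆ (∪-monoʳ (λ l∈ → x∈p∪q⁺ (inj₂ l∈))))
            ; x⋠y      = incomparable Ki Kj i≁j
            ; y⋠x      = incomparable Kj Ki (λ j∼i → i≁j (M.∼-sym j∼i))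
            ; isJoin   = isJoin
            }

      -- Away from the merged minimum a fibre is nontrivial only if `A` meets `K` and both halves
      -- are attained over `z`. If one half is not attained, all generators in `K` were equal over
      -- `z` beforehand.
      fibres : ∀ z A → (∀ {d} → M′.Same d (z , A) → M.Same d (z , A)) ⊎ Fibre z A
      fibres z A with z S′.~? a
      ... | yes z~′a = inj₂ (AtMerged.fibre z A z~′a)
      ... | no  z≁′a = away
        where
        open AwayFromMerged z A z≁′a
        away : (∀ {d} → M′.Same d (z , A) → M.Same d (z , A)) ⊎ Fibre z A
        away with Fin.any? (λ k → (k ∈? A) ×-dec K? k) |
                  Fin.any? (λ i → (γ i ∨ z) S.~? a) | Fin.any? (λ j → (γ j ∨ z) S.~? b)
        ... | yes (k , k∈A , Kk) | yes (i , Kai) | yes (j , Kbj) = inj₂ (fibre k∈A Kk Kai Kbj)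
        ... | no ¬K | _ | _ = inj₁ (singleton λ
              { (inj₁ i∈A) Ki _ → contradiction (_ , i∈A , Ki) ¬K
              ; (inj₂ j∈A) _ Kj → contradiction (_ , j∈A , Kj) ¬K })
        ... | yes _ | no ¬Ka | _ = inj₁ (singleton λ _ Ki Kj → same-class (b-class Ki) (b-class Kj))
          where
          b-class : ∀ {i} → K i → Kb i
          b-class Ki with class-a Ki
          ... | inj₁ Kai = contradiction (_ , Kai) ¬Ka
          ... | inj₂ Kbi = Kbi
        ... | yes _ | yes _ | no ¬Kb = inj₁ (singleton λ _ Ki Kj → same-class (a-class′ Ki) (a-class′ Kj))
          where
          a-class′ : ∀ {i} → K i → Ka i
          a-class′ Ki with class-a Ki
          ... | inj₁ Kai = Kai
          ... | inj₂ Kbi = contradiction (_ , Kbi) ¬Kb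

      fibres₋ : ∀ c → Singleton M.minors c ⊎ Triple M.minors c
      fibres₋ ⊥₋ = inj₁ λ { {⊥₋} _ → AddInfimum.⊥₋≤ ⊥₋ , AddInfimum.⊥₋≤ ⊥₋
                          ; {[ _ ]} (() , _) }
      fibres₋ [ z , A ] with fibres z A
      ... | inj₁ single = inj₁ λ { {⊥₋} (_ , ()) ; {[ _ ]} d≈c → M.Same⇒≈ (single (M′.≈⇒Same d≈c)) }
      ... | inj₂ fibre = inj₂ record
        { x = [ x ] ; y = [ y ] ; z = [ t ]
        ; x≈c    = M′.Same⇒≈ x≈c
        ; y≈c    = M′.Same⇒≈ y≈c
        ; z≈c    = M′.Same⇒≈ t≈c
        ; only   = λ { {⊥₋} (_ , ()) ; {[ _ ]} d≈c → classify₋ (classify (M′.≈⇒Same d≈c)) }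
        ; x≲z    = AddInfimum.[ x≼t ]
        ; y≲z    = AddInfimum.[ y≼t ]
        ; x≴y    = λ { AddInfimum.[ x≼y ] → x⋠y x≼y }
        ; y≴x    = λ { AddInfimum.[ y≼x ] → y⋠x y≼x }
        ; isJoin = λ { AddInfimum.[ x≼u ] AddInfimum.[ y≼u ] → AddInfimum.[ isJoin x≼u y≼u ] }
        }
        where
        open Fibre fibre
        open DecidablePreorder M.minors using (_≈_)
        classify₋ : ∀ {d} → M.Same d x ⊎ M.Same d y ⊎ M.Same d t →
                    [ d ] ≈ [ x ] ⊎ [ d ] ≈ [ y ] ⊎ [ d ] ≈ [ t ]
        classify₋ (inj₁ same)        = inj₁ (M.Same⇒≈ same)
        classify₋ (inj₂ (inj₁ same)) = inj₂ (inj₁ (M.Same⇒≈ same))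
        classify₋ (inj₂ (inj₂ same)) = inj₂ (inj₂ (M.Same⇒≈ same))

      elementary-↝ : (l : List ((L × Subset n) ₋)) → (∀ c → c ∈ₗ l) → M.minors ↝ M′.minors
      elementary-↝ l all∈ = collapse l all∈ M.minors fibration fibres₋

-- Coarsening one element at a time

module Chain {L : Set} (_∨_ : L → L → L) (0̂ : L) {n : ℕ} (γ : Fin n → L)
             (S₀ S∞ : JoinPreorder _∨_ 0̂) (_≟_ : DecidableEquality L)
             (elems : List L) (all∈elems : ∀ x → x ∈ₗ elems) where
  private
    module S₀ = JoinPreorder S₀
    module S∞ = JoinPreorder S∞
  open S₀ using () renaming (_⊑_ to _⊑₀_)
  open S∞ using () renaming (_⊑_ to _⊑∞_)
  open MinorPreorder _∨_ 0̂ γ using (minors)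

  ↝-minors : (S S′ : JoinPreorder _∨_ 0̂) →
             (∀ {x y} → JoinPreorder._⊑_ S x y → JoinPreorder._⊑_ S′ x y) →
             (∀ {x y} → JoinPreorder._⊑_ S′ x y → JoinPreorder._⊑_ S x y) → minors S ↝ minors S′
  ↝-minors S S′ S⇒S′ S′⇒S = same⇒↝ (minors S) (minors S′)
    (Collapse.Fibration.coarser (Coarsen.fibration _∨_ 0̂ γ S S′ S⇒S′))
    (Collapse.Fibration.coarser (Coarsen.fibration _∨_ 0̂ γ S′ S S′⇒S))

  module _ (antisym : ∀ {x y} → x ⊑₀ y → y ⊑₀ x → x ≡ y)
           (coarser : ∀ {x y} → x ⊑₀ y → x ⊑∞ y)
           (generated : ∀ {x u} → (∀ i → γ i ⊑₀ x → γ i ⊑₀ u) → x ⊑₀ u) where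

    open Membership _≟_ using () renaming (_∈?_ to _∈ₗ?_)

    allMinors : List ((L × Subset n) ₋)
    allMinors = ⊥₋ ∷ map [_] (cartesianProduct elems (subsets n))

    ∈-allMinors : ∀ c → c ∈ₗ allMinors
    ∈-allMinors ⊥₋          = here refl
    ∈-allMinors [ (z , A) ] =
      there (∈-map⁺ [_] (∈-cartesianProduct⁺ (all∈elems z) (∈-subsets A)))

    DownClosed : List L → Set
    DownClosed l = ∀ {x y} → x ∈ₗ l → y ⊑₀ x → y ∈ₗ l

    -- The up-set of elements outside l has been collapsed along S∞.
    stage : ∀ l → DownClosed l → JoinPreorder _∨_ 0̂
    stage l down = record
      { _⊑_     = λ x y → x ⊑₀ y ⊎ (¬ y ∈ₗ l × x ⊑∞ y)
      ; ⊑-refl  = inj₁ S₀.⊑-refl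
      ; ⊑-trans = tr
      ; _⊑?_    = λ x y → (x S₀.⊑? y) ⊎-dec (¬? (y ∈ₗ? l) ×-dec (x S∞.⊑? y))
      ; x⊑x∨y   = inj₁ S₀.x⊑x∨y
      ; y⊑x∨y   = inj₁ S₀.y⊑x∨y
      ; ∨-least = lub
      ; 0̂-least = inj₁ S₀.0̂-least
      }
      where
      tr : Transitive (λ x y → x ⊑₀ y ⊎ (¬ y ∈ₗ l × x ⊑∞ y))
      tr (inj₁ x⊑y)         (inj₁ y⊑u)         = inj₁ (S₀.⊑-trans x⊑y y⊑u)
      tr (inj₁ x⊑y)         (inj₂ (u∉l , y⊑u)) = inj₂ (u∉l , S∞.⊑-trans (coarser x⊑y) y⊑u)
      -- The complement of a down-closed list is an up-set, so `u` is outside `l` along with `y`.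
      tr (inj₂ (y∉l , x⊑y)) (inj₁ y⊑u)         =
        inj₂ ((λ u∈l → y∉l (down u∈l y⊑u)) , S∞.⊑-trans x⊑y (coarser y⊑u))
      tr (inj₂ (_ , x⊑y))   (inj₂ (u∉l , y⊑u)) = inj₂ (u∉l , S∞.⊑-trans x⊑y y⊑u)
      lub : ∀ {x y u} → x ⊑₀ u ⊎ (¬ u ∈ₗ l × x ⊑∞ u) → y ⊑₀ u ⊎ (¬ u ∈ₗ l × y ⊑∞ u) →
            (x ∨ y) ⊑₀ u ⊎ (¬ u ∈ₗ l × (x ∨ y) ⊑∞ u)
      lub (inj₁ x⊑u)         (inj₁ y⊑u)         = inj₁ (S₀.∨-least x⊑u y⊑u)
      lub (inj₂ (u∉l , x⊑u)) (inj₁ y⊑u)         = inj₂ (u∉l , S∞.∨-least x⊑u (coarser y⊑u))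
      lub (inj₁ x⊑u)         (inj₂ (u∉l , y⊑u)) = inj₂ (u∉l , S∞.∨-least (coarser x⊑u) y⊑u)
      lub (inj₂ (u∉l , x⊑u)) (inj₂ (_ , y⊑u))   = inj₂ (u∉l , S∞.∨-least x⊑u y⊑u)

    _≻_ : Rel L 0ℓ
    x ≻ y = y ⊑₀ x × ¬ x ⊑₀ y

    open TopologicalSort {_<_ = _≻_} (λ (x⊑x , x⋢x) → x⋢x x⊑x)
      (λ (y⊑x , x⋢y) (z⊑y , y⋢z) → S₀.⊑-trans z⊑y y⊑x , λ x⊑z → y⋢z (S₀.⊑-trans y⊑x x⊑z))
      (λ x y → (y S₀.⊑? x) ×-dec ¬? (x S₀.⊑? y))

    -- The order of the list puts larger elements first, so an entry of `l` above the head equals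
    -- it. In that case a repetition of the head remains in `l`.
    tail-downClosed : ∀ {a l} → Sorted (a ∷ l) → DownClosed (a ∷ l) → DownClosed l
    tail-downClosed {a} (l⊁a ∷ _) down {x} x∈l y⊑x with down (there x∈l) y⊑x
    ... | there y∈l = y∈l
    ... | here refl with x S₀.⊑? a
    ...   | yes x⊑a with antisym x⊑a y⊑x
    ...     | refl = x∈l
    tail-downClosed (l⊁a ∷ _) down x∈l y⊑x | here refl | no x⋢a =
      contradiction (y⊑x , x⋢a) (All.lookup l⊁a x∈l)

    module RemoveHead (a : L) (l : List L) (sorted : Sorted (a ∷ l)) (down : DownClosed (a ∷ l)) where

      S S′ : JoinPreorder _∨_ 0̂
      S  = stage (a ∷ l) down
      S′ = stage l (tail-downClosed sorted down)
      open JoinPreorder S using (_⊑_)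
      open JoinPreorder S′ using () renaming (_⊑_ to _⊑′_)

      finer : ∀ {x y} → x ⊑ y → x ⊑′ y
      finer (inj₁ x⊑y)         = inj₁ x⊑y
      finer (inj₂ (y∉l , x⊑y)) = inj₂ (y∉l ∘ there , x⊑y)

      below? : UnaryDecidable (λ i → γ i ⊑∞ a)
      below? i = γ i S∞.⊑? a

      -- The greatest element of the class of `a` under `S∞`: by `⊑b` it lies above everything that
      -- is `⊑∞ a`, including `a`.
      b : L
      b = ⋁[_] _∨_ 0̂ γ (collect below?)

      b⊑∞a : b ⊑∞ a
      b⊑∞a = S∞.⋁-least γ (∈-collect⁻ below?)

      ⊑b : ∀ {x} → x ⊑∞ a → x ⊑₀ b
      ⊑b x⊑a = generated λ i i⊑x →
        S₀.⋁-upper γ (∈-collect⁺ below? (S∞.⊑-trans (coarser i⊑x) x⊑a))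

      only : ∀ {x y} → x ⊑′ y → x ⊑ y ⊎ (x ⊑ b × y ≡ a)
      only (inj₁ x⊑y) = inj₁ (inj₁ x⊑y)
      only {y = y} (inj₂ (y∉l , x⊑y)) with y ≟ a
      ... | yes refl = inj₂ (inj₁ (⊑b x⊑y) , refl)
      ... | no  y≢a  = inj₁ (inj₂ ((λ { (here y≡a) → y≢a y≡a ; (there y∈l) → y∉l y∈l }) , x⊑y))

      -- Everything strictly above `a` has been processed, so there the relation is that of `S∞`,
      -- for which `b` and `a` are equivalent. This is what makes `b` the only upper cover.
      covers-a : ∀ {x} → a ⊑ x → x ⊑ a ⊎ b ⊑ x
      covers-a (inj₂ (x∉l , a⊑x)) = inj₂ (inj₂ (x∉l , S∞.⊑-trans b⊑∞a a⊑x))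
      covers-a {x} (inj₁ a⊑x) with x S₀.⊑? a
      ... | yes x⊑a = inj₁ (inj₁ x⊑a)
      ... | no  x⋢a = inj₂ (inj₂ (outside sorted , S∞.⊑-trans b⊑∞a (coarser a⊑x)))
        where
        outside : Sorted (a ∷ l) → ¬ x ∈ₗ a ∷ l
        outside _         (here refl) = x⋢a S₀.⊑-refl
        outside (l⊁a ∷ _) (there x∈l) = All.lookup l⊁a x∈l (a⊑x , x⋢a)

      ⊑a⇒⊑₀a : ∀ {x} → x ⊑ a → x ⊑₀ a
      ⊑a⇒⊑₀a (inj₁ x⊑a)       = x⊑a
      ⊑a⇒⊑₀a (inj₂ (a∉al , _)) = contradiction (here refl) a∉al

      step : minors S ↝ minors S′
      step with a ∈ₗ? l | b S₀.⊑? a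
      -- The list may repeat `a`; the identification waits for the last occurrence.
      ... | yes a∈l | _ = ↝-minors S S′ finer back
        where
        back : ∀ {x y} → x ⊑′ y → x ⊑ y
        back (inj₁ x⊑y)         = inj₁ x⊑y
        back (inj₂ (y∉l , x⊑y)) =
          inj₂ ((λ { (here refl) → y∉l a∈l ; (there y∈l) → y∉l y∈l }) , x⊑y)
      -- Here `a` is already the top of its class, and nothing is identified.
      ... | no _ | yes b⊑a = ↝-minors S S′ finer back
        where
        back : ∀ {x y} → x ⊑′ y → x ⊑ y
        back x⊑′y with only x⊑′y
        ... | inj₁ x⊑y          = x⊑y
        ... | inj₂ (x⊑b , refl) = JoinPreorder.⊑-trans S x⊑b (inj₁ b⊑a)
      ... | no a∉l | no b⋢a with Fin.any? (λ i → (γ i S₀.⊑? b) ×-dec ¬? (γ i S₀.⊑? a))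
      ...   | yes (g , g⊑b , g⋢a) =
        Coarsen.Elementary.elementary-↝ _∨_ 0̂ γ S S′ finer a b
          (inj₂ (a∉l , b⊑∞a)) only′ (inj₁ (⊑b S∞.⊑-refl)) (b⋢a ∘ ⊑a⇒⊑₀a) covers-a
          g (inj₁ g⊑b) (g⋢a ∘ ⊑a⇒⊑₀a) allMinors ∈-allMinors
        where
        only′ : ∀ {x y} → x ⊑′ y → x ⊑ y ⊎ (x ⊑ b × JoinPreorder._~_ S y a)
        only′ x⊑′y with only x⊑′y
        ... | inj₁ x⊑y          = inj₁ x⊑y
        ... | inj₂ (x⊑b , refl) = inj₂ (x⊑b , JoinPreorder.⊑-refl S , JoinPreorder.⊑-refl S)
      -- Generators detect the order, so `b` not below `a` must show at some generator, which serves
      -- as `g`.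
      ...   | no none = contradiction (generated below) b⋢a
        where
        below : ∀ i → γ i ⊑₀ b → γ i ⊑₀ a
        below i i⊑b with γ i S₀.⊑? a
        ... | yes i⊑a = i⊑a
        ... | no  i⋢a = contradiction (i , i⊑b , i⋢a) none

    stages-↝ : ∀ l → Sorted l → (down : DownClosed l) → minors (stage l down) ↝ minors S∞
    stages-↝ [] _ down = ↝-minors (stage [] down) S∞
      (λ { (inj₁ x⊑y) → coarser x⊑y ; (inj₂ (_ , x⊑y)) → x⊑y }) (λ x⊑y → inj₂ ((λ ()) , x⊑y))
    stages-↝ (a ∷ l) sorted@(_ ∷ s) down =
      ↝-trans {P = minors S} {Q = minors S′} {R = minors S∞} step (stages-↝ l s _)
      where open RemoveHead a l sorted down

    minors-↝ : minors S₀ ↝ minors S∞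
    minors-↝ = ↝-trans {P = minors S₀} {Q = minors S₁} {R = minors S∞}
      (↝-minors S₀ S₁ inj₁ λ { (inj₁ x⊑y) → x⊑y ; (inj₂ (y∉ , _)) → contradiction (all∈ _) y∉ })
      (stages-↝ (sort elems) (sort-sorted elems) _)
      where
      all∈ : ∀ x → x ∈ₗ sort elems
      all∈ x = ∈-sort elems (all∈elems x)
      S₁ = stage (sort elems) (λ {_} {y} _ _ → all∈ y)

-- Minors of generator-enriched lattices

x∈p─q⇒x∉q : ∀ {n x} (p q : Subset n) → x ∈ p ─ q → ¬ x ∈ q
x∈p─q⇒x∉q (_ ∷ p) (true ∷ q)  (there x∈) (there x∈q) = x∈p─q⇒x∉q p q x∈ x∈q
x∈p─q⇒x∉q (_ ∷ p) (false ∷ q) (there x∈) (there x∈q) = x∈p─q⇒x∉q p q x∈ x∈q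

p─[p─q]≡q : ∀ {n} (p q : Subset n) → q ⊆ p → p ─ (p ─ q) ≡ q
p─[p─q]≡q p q q⊆p = ⊆-antisym forth back
  where
  forth : p ─ (p ─ q) ⊆ q
  forth {x} x∈ with x ∈? q
  ... | yes x∈q = x∈q
  ... | no  x∉q = contradiction (x∈p∧x∉q⇒x∈p─q (p─q⊆p p (p ─ q) x∈) x∉q) (x∈p─q⇒x∉q p (p ─ q) x∈)
  back : q ⊆ p ─ (p ─ q)
  back x∈q = x∈p∧x∉q⇒x∈p─q (q⊆p x∈q) (λ x∈ → x∈p─q⇒x∉q p q x∈ x∈q)

module FiniteLatticeProperties (𝓛 : FiniteLattice) where
  open FiniteLattice 𝓛 renaming (_∈_ to _∈ᴸ_)

  element-index : ∀ x → element (index x) ≡ x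
  element-index x = Inverse.strictlyInverseʳ finite x

  _≤?_ : Decidable _≤_
  x ≤? y = map′ (λ eq → ≤-trans (x≤x∨y _ _) (reflexive eq))
                (λ x≤y → antisym (∨-least x≤y ≤-refl) (y≤x∨y _ _)) ((x ∨ y) ≟ y)

  foldr-upper : ∀ {x} xs → x ∈ₗ xs → x ≤ foldr _∨_ 0̂ xs
  foldr-upper (x ∷ xs) (here refl) = x≤x∨y _ _
  foldr-upper (x ∷ xs) (there x∈)  = ≤-trans (foldr-upper xs x∈) (y≤x∨y _ _)

  foldr-least : ∀ {u} xs → All (_≤ u) xs → foldr _∨_ 0̂ xs ≤ u
  foldr-least []       []          = 0̂-minimum _
  foldr-least (x ∷ xs) (x≤u ∷ xs≤) = ∨-least x≤u (foldr-least xs xs≤)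

  elements-of : Subset size → List Carrier
  elements-of X = map element (filter (_∈? X) (allFin size))

  ∈-elements-of⁻ : ∀ {x} X → x ∈ₗ elements-of X → ∃[ i ] (i ∈ X × x ≡ element i)
  ∈-elements-of⁻ X x∈ with ∈-map⁻ element x∈
  ... | i , i∈ , refl = i , proj₂ (∈-filter⁻ (_∈? X) {xs = allFin size} i∈) , refl

  ⋁-upper : ∀ {X i} → i ∈ X → element i ≤ ⋁ X
  ⋁-upper {X} {i} i∈X =
    foldr-upper (elements-of X) (∈-map⁺ element (∈-filter⁺ (_∈? X) (∈-allFin i) i∈X))

  ⋁-least : ∀ {X u} → (∀ {i} → i ∈ X → element i ≤ u) → ⋁ X ≤ u
  ⋁-least {X} {u} X≤u = foldr-least (elements-of X) (All.tabulate λ x∈ → bound (∈-elements-of⁻ X x∈))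
    where
    bound : ∀ {x} → ∃[ i ] (i ∈ X × x ≡ element i) → x ≤ u
    bound (_ , i∈X , refl) = X≤u i∈X

-- The minor relation without sequences of operations

module MinorCharacterization (LG : GeneratorEnrichedLattice) where
  open GeneratorEnrichedLattice LG hiding (_∈_)
  open Minors LG
  open Proper
  open FiniteLatticeProperties lattice

  infix 4 _⊴_

  -- `least` expresses that a contraction of `M` can reach the minimum of `N`, and `covered` that a
  -- deletion can then leave its generators. The clauses mirror `Reaches` and `Covers`, so encoded
  -- minors can be compared with actual ones clause by clause.
  record _⊴_ (N M : Sub) : Set where
    field
      min≤min : minimum M ≤ minimum N
      least   : ∀ u → minimum M ≤ u →
                (∀ h → h ∈ generators M → element h ≤ minimum N → element h ≤ u) → minimum N ≤ u
      covered : ∀ {h} → h ∈ generators N → Contracted (generators M) (minimum N) (element h)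

  open _⊴_

  ⊴-refl : ∀ {M} → Proper M → M ⊴ M
  ⊴-refl pr .min≤min = ≤-refl
  ⊴-refl pr .least _ M≤u _ = M≤u
  ⊴-refl pr .covered {h} h∈ = let M≤h , h≢M = minimum<generators pr h∈ in
    (h , h∈ , sym (∨-identityʳ M≤h)) , h≢M

  ⊴-trans : ∀ {P N M} → P ⊴ N → N ⊴ M → P ⊴ M
  ⊴-trans p q .min≤min = ≤-trans (min≤min q) (min≤min p)
  ⊴-trans {P} {N} {M} p q .least u M≤u reached = least p u N≤u reached′
    where
    N≤u : minimum N ≤ u
    N≤u = least q u M≤u λ h h∈ h≤N → reached h h∈ (≤-trans h≤N (min≤min p))
    reached′ : ∀ h → h ∈ generators N → element h ≤ minimum P → element h ≤ u
    reached′ h h∈ h≤P with covered q h∈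
    ... | (g , g∈ , eq) , _ = ≤-trans (reflexive eq) (∨-least
      (reached g g∈ (≤-trans (≤-trans (x≤x∨y _ _) (reflexive (sym eq))) h≤P)) N≤u)
  ⊴-trans {P} {N} {M} p q .covered {h} h∈ with covered p h∈
  ... | (g , g∈ , eq) , h≢ with covered q g∈
  ...   | (k , k∈ , eq′) , _ = (k , k∈ , antisym h≤ h≥) , h≢
    where
    h≤ : element h ≤ element k ∨ minimum P
    h≤ = ≤-trans (reflexive eq) (∨-least (≤-trans (reflexive eq′)
           (∨-least (x≤x∨y _ _) (≤-trans (min≤min p) (y≤x∨y _ _)))) (y≤x∨y _ _))
    h≥ : element k ∨ minimum P ≤ element h
    h≥ = ≤-trans (∨-least (≤-trans (≤-trans (x≤x∨y _ _) (reflexive (sym eq′))) (x≤x∨y _ _))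
           (y≤x∨y _ _)) (reflexive (sym eq))

  ⟶⇒⊴ : ∀ {M N} → Proper M → M ⟶ N → N ⊴ M
  ⟶⇒⊴ {M} pr (delete I _) = record
    { min≤min = ≤-refl
    ; least   = λ _ M≤u _ → M≤u
    ; covered = λ h∈ → covered (⊴-refl pr) (p─q⊆p (generators M) I h∈)
    }
  ⟶⇒⊴ {M} pr (contract I I⊆) = record
    { min≤min = x≤x∨y _ _
    ; least   = λ u M≤u reached → ∨-least M≤u (⋁-least λ {i} i∈I →
        reached i (I⊆ i∈I) (≤-trans (⋁-upper i∈I) (y≤x∨y _ _)))
    ; covered = comprehension⁻ (contracted? (generators M) (joinIn M I))
    }

  ≼⇒⊴ : ∀ {M N} → Proper M → N ≼ M → N ⊴ M
  ≼⇒⊴ pr ε          = ⊴-refl pr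
  ≼⇒⊴ pr (s ◅ rest) = ⊴-trans (≼⇒⊴ (⟶-proper s pr) rest) (⟶⇒⊴ pr s)

  Proper-ext : ∀ {M N} → Proper M → Proper N →
               minimum M ≡ minimum N → generators M ≡ generators N → M ≡ N
  Proper-ext {sub _ H z} pr pr′ refl refl =
    cong (λ E → sub E H z) (trans (elements≡span pr) (sym (elements≡span pr′)))

  -- One contraction followed by one deletion suffices: contract all generators of `M` below the
  -- minimum of `N`, then delete what is not a generator of `N`.
  ⊴⇒≼ : ∀ {M N} → Proper M → Proper N → N ⊴ M → N ≼ M
  ⊴⇒≼ {M} {N} prM prN N⊴M = subst (_≼ M) same (contraction ◅ deletion ◅ ε)
    where
    below? : UnaryDecidable (λ h → h ∈ generators M × element h ≤ minimum N)
    below? h = (h ∈? generators M) ×-dec (element h ≤? minimum N)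
    I : Subset size
    I = collect below?
    J : Subset size
    J = generators (M / I) ─ generators N
    contraction : M ⟶ M / I
    contraction = contract I (λ h∈ → proj₁ (∈-collect⁻ below? h∈))
    deletion : M / I ⟶ M / I ∖ J
    deletion = delete J (p─q⊆p (generators (M / I)) (generators N))
    min≡ : joinIn M I ≡ minimum N
    min≡ = antisym
      (∨-least (min≤min N⊴M) (⋁-least λ h∈ → proj₂ (∈-collect⁻ below? h∈)))
      (least N⊴M _ (x≤x∨y _ _) λ h h∈ h≤N →
        ≤-trans (⋁-upper (∈-collect⁺ below? (h∈ , h≤N))) (y≤x∨y _ _))
    N⊆ : generators N ⊆ generators (M / I)
    N⊆ {h} h∈ = comprehension⁺ (contracted? (generators M) (joinIn M I))
      (subst (λ z → Contracted (generators M) z (element h)) (sym min≡) (covered N⊴M h∈))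
    same : M / I ∖ J ≡ N
    same = Proper-ext (⟶-proper deletion (⟶-proper contraction prM)) prN min≡
      (p─[p─q]≡q (generators (M / I)) (generators N) N⊆)

module GeneratorFamily (LG : GeneratorEnrichedLattice) where
  open GeneratorEnrichedLattice LG hiding (_∈_)
  open FiniteLatticeProperties lattice

  -- Indices outside G yield 0̂, which never contributes to a minor.
  γ : Fin size → Carrier
  γ i with i ∈? G
  ... | yes _ = element i
  ... | no  _ = 0̂

  γ-cases : ∀ i → (i ∈ G × γ i ≡ element i) ⊎ γ i ≡ 0̂
  γ-cases i with i ∈? G
  ... | yes i∈G = inj₁ (i∈G , refl)
  ... | no  _   = inj₂ refl

  γ-G : ∀ {i} → i ∈ G → γ i ≡ element i
  γ-G {i} i∈G with i ∈? G
  ... | yes _   = refl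
  ... | no  i∉G = contradiction i∈G i∉G

  generated : ∀ {x u} → (∀ i → γ i ≤ x → γ i ≤ u) → x ≤ u
  generated {x} {u} below with generates x
  ... | X , X⊆G , refl = ⋁-least λ {i} i∈X →
    subst (_≤ u) (γ-G (X⊆G i∈X)) (below i (subst (_≤ x) (sym (γ-G (X⊆G i∈X))) (⋁-upper i∈X)))

-- Encoding the minors of the image of a strong surjection

module MinorsOfImage (LG KH : GeneratorEnrichedLattice)
                     (f : GeneratorEnrichedLattice.Carrier LG → GeneratorEnrichedLattice.Carrier KH)
                     (isStrongSurjection : IsStrongSurjection LG KH f) where
  private
    module L = GeneratorEnrichedLattice LG
  open GeneratorEnrichedLattice KH hiding (_∈_)
  open IsStrongSurjection isStrongSurjection
  open IsStrongMap isStrongMap renaming (generators to f-generators)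
  open FiniteLatticeProperties lattice
  open GeneratorFamily LG
  open Minors KH
  open Proper
  open MinorCharacterization KH
  open _⊴_

  kernel : JoinPreorder L._∨_ L.0̂
  kernel = record
    { _⊑_     = λ x y → f x ≤ f y
    ; ⊑-refl  = ≤-refl
    ; ⊑-trans = ≤-trans
    ; _⊑?_    = λ x y → f x ≤? f y
    ; x⊑x∨y   = ≤-trans (x≤x∨y _ _) (reflexive (sym (preserves-∨ _ _)))
    ; y⊑x∨y   = ≤-trans (y≤x∨y _ _) (reflexive (sym (preserves-∨ _ _)))
    ; ∨-least = λ x≤u y≤u → ≤-trans (reflexive (preserves-∨ _ _)) (∨-least x≤u y≤u)
    ; 0̂-least = ≤-trans (reflexive preserves-0̂) (0̂-minimum _)
    }

  open MinorPreorder L._∨_ L.0̂ γ kernel using (Covers; minors)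
    renaming (_≼_ to _≼ᴸ_)

  preimage-foldr : ∀ xs → All (λ y → ∃[ x ] f x ≡ y) xs → ∃[ x ] f x ≡ foldr _∨_ 0̂ xs
  preimage-foldr []       []             = L.0̂ , preserves-0̂
  preimage-foldr (y ∷ ys) ((x , refl) ∷ pres) with preimage-foldr ys pres
  ... | x′ , eq = x L.∨ x′ , trans (preserves-∨ x x′) (cong (f x ∨_) eq)

  -- The hypothesis gives preimages of generators only; preservation of joins extends this to any
  -- join of generators.
  f-surjective : ∀ y → ∃[ x ] f x ≡ y
  f-surjective y with generates y
  ... | Y , Y⊆H , refl = preimage-foldr (elements-of Y)
    (All.tabulate λ y∈ → preimage (∈-elements-of⁻ Y y∈))
    where
    preimage : ∀ {y} → ∃[ i ] (i ∈ Y × y ≡ element i) → ∃[ x ] f x ≡ y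
    preimage (i , i∈Y , refl) with Equivalence.to (surjective (element i))
                                     (inj₁ (subst (_∈ G) (sym (index-element i)) (Y⊆H i∈Y)))
    ... | x , _ , fx≡ = x , fx≡

  Generator : L.Carrier → Subset L.size → Carrier → Set
  Generator z A x = (∃[ i ] (i ∈ A × x ≡ f (γ i) ∨ f z)) × x ≢ f z

  generator? : ∀ z A → UnaryDecidable (Generator z A)
  generator? z A x = Fin.any? (λ i → (i ∈? A) ×-dec (x ≟ f (γ i) ∨ f z)) ×-dec ¬? (x ≟ f z)

  image : L.Carrier × Subset L.size → Sub
  image (z , A) = ⟨ comprehension (generator? z A) ∣ f z ⟩

  image⁻ : ∀ {z A h} → h ∈ generators (image (z , A)) → Generator z A (element h)
  image⁻ {z} {A} = comprehension⁻ (generator? z A)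

  image⁺ : ∀ {z A i} → i ∈ A → f (γ i) ∨ f z ≢ f z →
           index (f (γ i) ∨ f z) ∈ generators (image (z , A))
  image⁺ {z} {A} {i} i∈A ≢fz = comprehension⁺ (generator? z A)
    (subst (Generator z A) (sym (element-index _)) ((i , i∈A , refl) , ≢fz))

  image-proper : ∀ p → Proper (image p)
  image-proper p .elements≡span = refl
  image-proper p .minimum<generators h∈ with image⁻ h∈
  ... | (i , _ , eq) , h≢ = ≤-trans (y≤x∨y _ _) (reflexive (sym eq)) , h≢

  -- `f z` is a join of generators. As `f` is strong, each `f (γ i)` is a generator or `0̂`, and in
  -- the second case it is absorbed by `f z`.
  image⊴whole : ∀ p → image p ⊴ whole
  image⊴whole (z , A) .min≤min = 0̂-minimum _
  image⊴whole (z , A) .least u _ reached with generates (f z)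
  ... | X , X⊆H , eq = ≤-trans (reflexive eq) (⋁-least λ {h} h∈X →
    reached h (X⊆H h∈X) (≤-trans (⋁-upper h∈X) (reflexive (sym eq))))
  image⊴whole (z , A) .covered {h} h∈ with image⁻ h∈
  ... | (i , _ , eq) , h≢ with image-γ i
    where
    image-γ : ∀ i → index (f (γ i)) ∈ G ⊎ f (γ i) ≡ 0̂
    image-γ i with γ-cases i
    ... | inj₂ γ≡0 = inj₂ (trans (cong f γ≡0) preserves-0̂)
    ... | inj₁ (i∈G , γ≡) = f-generators
      (subst (_∈ L.G) (sym (trans (cong L.index γ≡) (Inverse.strictlyInverseˡ L.finite i))) i∈G)
  ...   | inj₁ fγ∈ = (index (f (γ i)) , fγ∈ ,
                      trans eq (cong (_∨ f z) (sym (element-index _)))) , h≢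
  ...   | inj₂ fγ≡ = contradiction
    (trans eq (trans (cong (_∨ f z) fγ≡) (∨-identityˡ (0̂-minimum _)))) h≢

  ≼⇒image⊴ : ∀ {p q} → p ≼ᴸ q → image p ⊴ image q
  ≼⇒image⊴ {z′ , A′} {z , A} ((z≤z′ , least′) , cov) = record
    { min≤min = z≤z′ ; least = least″ ; covered = covered″ }
    where
    least″ : ∀ u → f z ≤ u →
             (∀ h → h ∈ generators (image (z , A)) → element h ≤ f z′ → element h ≤ u) → f z′ ≤ u
    least″ u z≤u reached with f-surjective u
    -- The bounds in `Reaches` range over `L`, so `u` is replaced by a preimage.
    ... | v , refl = least′ v z≤u reached′
      where
      reached′ : ∀ j → j ∈ A → f (γ j) ≤ f z′ → f (γ j) ≤ f v
      reached′ j j∈A j≤z′ with f (γ j) ∨ f z ≟ f z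
      -- A generator absorbed by `f z` is missing from the image, but it is below `u` anyway.
      ... | yes eq = ≤-trans (≤-trans (x≤x∨y _ _) (reflexive eq)) z≤u
      ... | no  ≢z = ≤-trans (≤-trans (x≤x∨y _ _) (reflexive (sym (element-index _))))
        (reached _ (image⁺ j∈A ≢z) (≤-trans (reflexive (element-index _)) (∨-least j≤z′ z≤z′)))
    covered″ : ∀ {h} → h ∈ generators (image (z′ , A′)) →
               Contracted (generators (image (z , A))) (f z′) (element h)
    covered″ {h} h∈ with image⁻ h∈
    ... | (i , i∈A′ , eq) , h≢ with cov i i∈A′
    ...   | inj₁ i≤z′ = contradiction (trans eq (∨-identityˡ i≤z′)) h≢
    ...   | inj₂ (j , j∈A , i≤j∨ , j≤i∨) =
      (index (f (γ j) ∨ f z) , image⁺ j∈A j≢z , antisym h≤ h≥) , h≢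
      where
      i≤j : f (γ i) ≤ f (γ j) ∨ f z′
      i≤j = ≤-trans i≤j∨ (reflexive (preserves-∨ _ _))
      j≤i : f (γ j) ≤ f (γ i) ∨ f z′
      j≤i = ≤-trans j≤i∨ (reflexive (preserves-∨ _ _))
      j≢z : f (γ j) ∨ f z ≢ f z
      j≢z j≡z = h≢ (trans eq (∨-identityˡ i≤z′))
        where
        i≤z′ : f (γ i) ≤ f z′
        i≤z′ = ≤-trans i≤j (∨-least (≤-trans (≤-trans (x≤x∨y _ _) (reflexive j≡z)) z≤z′) ≤-refl)
      h≤ : element h ≤ element (index (f (γ j) ∨ f z)) ∨ f z′
      h≤ = ≤-trans (reflexive eq) (∨-least (≤-trans i≤j (∨-least
        (≤-trans (≤-trans (x≤x∨y _ _) (reflexive (sym (element-index _)))) (x≤x∨y _ _))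
        (y≤x∨y _ _))) (y≤x∨y _ _))
      h≥ : element (index (f (γ j) ∨ f z)) ∨ f z′ ≤ element h
      h≥ = ≤-trans (∨-least (≤-trans (reflexive (element-index _))
        (∨-least j≤i (≤-trans z≤z′ (y≤x∨y _ _)))) (y≤x∨y _ _)) (reflexive (sym eq))

  image⊴⇒≼ : ∀ {p q} → image p ⊴ image q → p ≼ᴸ q
  image⊴⇒≼ {z′ , A′} {z , A} le = (min≤min le , λ u z≤u reached → least le (f u) z≤u (reached′ u z≤u reached)) , cov
    where
    reached′ : ∀ u → f z ≤ f u → (∀ j → j ∈ A → f (γ j) ≤ f z′ → f (γ j) ≤ f u) →
               ∀ h → h ∈ generators (image (z , A)) → element h ≤ f z′ → element h ≤ f u
    reached′ u z≤u reached h h∈ h≤z′ with image⁻ h∈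
    ... | (j , j∈A , eq) , _ = ≤-trans (reflexive eq) (∨-least
      (reached j j∈A (≤-trans (≤-trans (x≤x∨y _ _) (reflexive (sym eq))) h≤z′)) z≤u)
    cov : Covers z′ A′ A
    cov i i∈A′ with f (γ i) ∨ f z′ ≟ f z′
    ... | yes eq = inj₁ (≤-trans (x≤x∨y _ _) (reflexive eq))
    ... | no  ≢z′ with covered le (image⁺ i∈A′ ≢z′)
    ...   | (g , g∈ , eq) , _ with image⁻ g∈
    ...     | (j , j∈A , eq′) , _ = inj₂ (j , j∈A , i≤j , j≤i)
      where
      eq″ : f (γ i) ∨ f z′ ≡ (f (γ j) ∨ f z) ∨ f z′
      eq″ = trans (sym (element-index _)) (trans eq (cong (_∨ f z′) eq′))
      i≤j : f (γ i) ≤ f (γ j L.∨ z′)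
      i≤j = ≤-trans (≤-trans (x≤x∨y _ _) (reflexive eq″)) (≤-trans
        (∨-least (∨-least (x≤x∨y _ _) (≤-trans (min≤min le) (y≤x∨y _ _))) (y≤x∨y _ _))
        (reflexive (sym (preserves-∨ _ _))))
      j≤i : f (γ j) ≤ f (γ i L.∨ z′)
      j≤i = ≤-trans (≤-trans (x≤x∨y _ _) (x≤x∨y _ _))
        (≤-trans (reflexive (sym eq″)) (reflexive (sym (preserves-∨ _ _))))

  module _ (N : Sub) (prN : Proper N) (N⊴whole : N ⊴ whole) where

    z : L.Carrier
    z = proj₁ (f-surjective (minimum N))

    fz≡ : f z ≡ minimum N
    fz≡ = proj₂ (f-surjective (minimum N))

    -- Every index that yields a generator of `N` over `z` is taken, which avoids choosing one
    -- preimage for each generator.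
    lies? : UnaryDecidable (λ i → index (f (γ i) ∨ f z) ∈ generators N)
    lies? i = index (f (γ i) ∨ f z) ∈? generators N

    A : Subset L.size
    A = collect lies?

    image⊆N : generators (image (z , A)) ⊆ generators N
    image⊆N {h} h∈ with image⁻ h∈
    ... | (i , i∈A , eq) , _ = subst (_∈ generators N)
      (trans (cong index (sym eq)) (index-element h)) (∈-collect⁻ lies? i∈A)

    N⊆image : generators N ⊆ generators (image (z , A))
    N⊆image {h} h∈ with covered N⊴whole h∈
    ... | (g , g∈H , eq) , h≢ with Equivalence.to (surjective (element g))
                                     (inj₁ (subst (_∈ G) (sym (index-element g)) g∈H))
    -- A generator with preimage `0̂` would itself be `0̂`, and then `h` would be the minimum of
    -- `N`.
    ...   | _ , inj₂ refl , fx≡ = contradiction (trans eq (trans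
      (cong (_∨ minimum N) (trans (sym fx≡) preserves-0̂)) (∨-identityˡ (0̂-minimum _)))) h≢
    ...   | x , inj₁ x∈G , fx≡ = comprehension⁺ (generator? z A)
      ((i , ∈-collect⁺ lies? (subst (_∈ generators N) (trans (sym (index-element h)) (cong index h≡)) h∈) , h≡) ,
       λ h≡fz → h≢ (trans h≡fz fz≡))
      where
      i = L.index x
      fγ≡ : f (γ i) ≡ element g
      fγ≡ = trans (cong f (trans (γ-G x∈G) (Inverse.strictlyInverseʳ L.finite x))) fx≡
      h≡ : element h ≡ f (γ i) ∨ f z
      h≡ = trans eq (sym (trans (cong (_∨ f z) fγ≡) (cong (element g ∨_) fz≡)))

    image-surjective : image (z , A) ≡ N
    image-surjective = Proper-ext (image-proper (z , A)) prN fz≡ (⊆-antisym image⊆N N⊆image)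

  imageMinor : L.Carrier × Subset L.size → Minor
  imageMinor p = image p , ⊴⇒≼ whole-proper (image-proper p) (image⊴whole p)

  minors⇄M : DecidablePreorder.quotient minors ⇄ M KH
  minors⇄M = record
    { to      = Maybe.map imageMinor
    ; from    = Maybe.map source
    ; mono    = λ { (AddInfimum.⊥₋≤ _) → AddInfimum.⊥₋≤ _
                  ; AddInfimum.[ p≼q ] →
                      AddInfimum.[ ⊴⇒≼ (image-proper _) (image-proper _) (≼⇒image⊴ p≼q) ] }
    ; cancel  = cancel
    ; to-from = λ { ⊥₋ → InfimumEquality.⊥₋≈⊥₋
                  ; [ N ] → InfimumEquality.[ image-surjective (proj₁ N) (proper N) (minor⊴ N) ] }
    }
    where
    proper : (N : Minor) → Proper (proj₁ N)
    proper (_ , N≼) = ≼-proper N≼ whole-proper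
    minor⊴ : (N : Minor) → proj₁ N ⊴ whole
    minor⊴ (_ , N≼) = ≼⇒⊴ whole-proper N≼
    source : Minor → L.Carrier × Subset L.size
    source N = z (proj₁ N) (proper N) (minor⊴ N) , A (proj₁ N) (proper N) (minor⊴ N)
    cancel : ∀ {p q} → Poset._≤_ (M KH) (Maybe.map imageMinor p) (Maybe.map imageMinor q) →
             DecidablePreorder._≲_ minors p q
    cancel {⊥₋}            _                   = AddInfimum.⊥₋≤ _
    cancel {[ p ]} {[ q ]} AddInfimum.[ p≼q ] = AddInfimum.[ image⊴⇒≼ (≼⇒⊴ (image-proper q) p≼q) ]

-- The zipping sequence between the two minor posets

identity-isStrongSurjection : ∀ LG → IsStrongSurjection LG LG (λ x → x)
identity-isStrongSurjection LG = record
  { isStrongMap = record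
    { preserves-0̂ = refl ; preserves-∨ = λ _ _ → refl ; generators = inj₁ }
  ; surjective  = λ y → mk⇔ (λ y∈ → y , y∈ , refl) λ { (_ , y∈ , refl) → y∈ }
  }

theorem5p2 : (LG KH : GeneratorEnrichedLattice) →
    (∃[ f ] IsStrongSurjection LG KH f) →
    M LG ZipsTo* M KH
theorem5p2 LG KH (f , surj) =
  -- The general `R` in `_↝_` is taken to be `M LG` itself, so the sequence starts exactly there.
  let R , steps , R⇄ = minors-↝ (⇄-sym Source.minors⇄M)
  in  R , steps , ⇄⇒≅ (⇄-trans R⇄ Target.minors⇄M)
  where
  open GeneratorEnrichedLattice LG
  open FiniteLatticeProperties lattice
  open GeneratorFamily LG
  module K = GeneratorEnrichedLattice KH
  -- The minors of `L` are encoded as those of the image of the identity, so both ends of the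
  -- sequence are preorders on the same pairs.
  module Source = MinorsOfImage LG LG (λ x → x) (identity-isStrongSurjection LG)
  module Target = MinorsOfImage LG KH f surj
  module S∞ = JoinPreorder Target.kernel
  coarser : ∀ {x y} → x ≤ y → f x K.≤ f y
  coarser x≤y = S∞.⊑-trans S∞.x⊑x∨y (K.reflexive (cong f (∨-identityˡ x≤y)))
    where open Minors LG using (∨-identityˡ)
  all∈elements : ∀ x → x ∈ₗ map element (allFin size)
  all∈elements x = subst (_∈ₗ map element (allFin size)) (element-index x)
    (∈-map⁺ element (∈-allFin (index x)))
  minors-↝ = Chain.minors-↝ _∨_ 0̂ γ Source.kernel Target.kernel _≟_
    (map element (allFin size)) all∈elements antisym coarser generated
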